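{- Let $t\geq 2$ be an integer. If $G$ is a connected $K_{3,t}$-minor-free graph, then $c(G)\leq t$.
   Context: All graphs are finite and simple. $K_{s,t}$ is the complete bipartite graph with parts of sizes $s$ and $t$. A graph $G$ is $H$-minor-free if no graph isomorphic to $H$ can be obtained from $G$ by deleting vertices, deleting edges and contracting edges. Cop number: in the game of cops and robbers on $G$, one player places $m$ cops on (not necessarily distinct) vertices, then the other player places the robber on a vertex. Then, starting with the cops, the players alternate turns; on a turn, a player may move any of their pieces to an adjacent vertex (each piece moves at most once, and any piece may stay put). The cops win if at some point some cop occupies the same vertex as the robber; the robber wins by evading capture forever. The cop number $c(G)$ is the minimum $m$ such that the cops have a winning strategy. -}

module Defs where

open import Data.Empty using (⊥)
open import Data.Fin using (Fin; _≟_; punchIn; punchOut; splitAt)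
open import Data.Fin.Properties using (any?)
open import Data.List using (List; []; _∷_)
open import Data.Nat using (ℕ; zero; suc; _+_; _≤_)
open import Data.Product using (_×_; _,_; ∃-syntax)
open import Data.Sum using (_⊎_; inj₁; inj₂)
open import Data.Unit using (⊤; tt)
open import Function using (_∘_; _⇔_; _↔_; Inverse)
open import Level using (0ℓ)
open import Relation.Binary.Construct.Closure.ReflexiveTransitive using (Star)
open import Relation.Binary.Core using (Rel)
open import Relation.Binary.Definitions using (Decidable; Irreflexive; Symmetric)
open import Relation.Binary.PropositionalEquality using (_≡_; _≢_; refl; sym)
open import Relation.Nullary using (¬_; yes; no; ¬?; _×-dec_; _⊎-dec_)

record Graph (n : ℕ) : Set₁ where
  field
    Adj        : Rel (Fin n) 0ℓ
    adj?       : Decidable Adj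
    adj-sym    : Symmetric Adj
    adj-irrefl : Irreflexive _≡_ Adj

open Graph public

-- The graph with no vertices counts as connected; its cop number below is 0.
Connected : ∀ {n} → Graph n → Set
Connected G = ∀ u v → Star (Adj G) u v

record _≅_ {m n : ℕ} (G : Graph m) (H : Graph n) : Set where
  field
    vertices : Fin m ↔ Fin n
    edges    : ∀ x y →
               Adj G x y ⇔ Adj H (Inverse.to vertices x) (Inverse.to vertices y)

Opposite : ∀ {A B : Set} → Rel (A ⊎ B) 0ℓ
Opposite (inj₁ _) (inj₁ _) = ⊥
Opposite (inj₁ _) (inj₂ _) = ⊤
Opposite (inj₂ _) (inj₁ _) = ⊤
Opposite (inj₂ _) (inj₂ _) = ⊥

opposite? : ∀ {A B : Set} → Decidable (Opposite {A} {B})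
opposite? (inj₁ _) (inj₁ _) = no λ ()
opposite? (inj₁ _) (inj₂ _) = yes tt
opposite? (inj₂ _) (inj₁ _) = yes tt
opposite? (inj₂ _) (inj₂ _) = no λ ()

opposite-sym : ∀ {A B : Set} → Symmetric (Opposite {A} {B})
opposite-sym {x = inj₁ _} {inj₂ _} _ = tt
opposite-sym {x = inj₂ _} {inj₁ _} _ = tt

opposite-irrefl : ∀ {A B : Set} → Irreflexive _≡_ (Opposite {A} {B})
opposite-irrefl {x = inj₁ _} refl ()
opposite-irrefl {x = inj₂ _} refl ()

-- The first s vertices form one part, the last t the other.
K : ∀ s t → Graph (s + t)
K s t = record
  { Adj        = λ x y → Opposite (splitAt s x) (splitAt s y)
  ; adj?       = λ x y → opposite? (splitAt s x) (splitAt s y)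
  ; adj-sym    = λ {x} {y} → opposite-sym {x = splitAt s x} {splitAt s y}
  ; adj-irrefl = λ { {x} refl → opposite-irrefl {x = splitAt s x} refl }
  }

deleteVertex : ∀ {n} → Graph (suc n) → Fin (suc n) → Graph n
deleteVertex G v = record
  { Adj        = λ x y → Adj G (punchIn v x) (punchIn v y)
  ; adj?       = λ x y → adj? G (punchIn v x) (punchIn v y)
  ; adj-sym    = adj-sym G
  ; adj-irrefl = λ { refl → adj-irrefl G refl }
  }

SamePair : ∀ {n} (u v x y : Fin n) → Set
SamePair u v x y = (x ≡ u × y ≡ v) ⊎ (x ≡ v × y ≡ u)

samePair? : ∀ {n} (u v : Fin n) → Decidable (SamePair u v)
samePair? u v x y = ((x ≟ u) ×-dec (y ≟ v)) ⊎-dec ((x ≟ v) ×-dec (y ≟ u))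

samePair-sym : ∀ {n} (u v : Fin n) → Symmetric (SamePair u v)
samePair-sym u v (inj₁ (p , q)) = inj₂ (q , p)
samePair-sym u v (inj₂ (p , q)) = inj₁ (q , p)

deleteEdge : ∀ {n} → Graph n → (u v : Fin n) → Graph n
deleteEdge G u v = record
  { Adj        = λ x y → Adj G x y × ¬ SamePair u v x y
  ; adj?       = λ x y → adj? G x y ×-dec ¬? (samePair? u v x y)
  ; adj-sym    = λ (e , ne) → adj-sym G e , ne ∘ samePair-sym u v
  ; adj-irrefl = λ { refl (e , _) → adj-irrefl G refl e }
  }

-- Identifies v with u and is injective otherwise.
merge : ∀ {n} (u v : Fin (suc n)) → v ≢ u → Fin (suc n) → Fin n
merge u v v≢u x with v ≟ x
... | yes _  = punchOut v≢u
... | no v≢x = punchOut v≢x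

-- The image of G under merge, without the loop coming from uv and without
-- parallel edges.
contractEdge : ∀ {n} (G : Graph (suc n)) (u v : Fin (suc n)) → Adj G u v → Graph n
contractEdge G u v e = record
  { Adj        = λ x y → x ≢ y × ∃[ a ] ∃[ b ] (f a ≡ x × f b ≡ y × Adj G a b)
  ; adj?       = λ x y → ¬? (x ≟ y) ×-dec any? λ a → any? λ b →
                   (f a ≟ x) ×-dec (f b ≟ y) ×-dec adj? G a b
  ; adj-sym    = λ (x≢y , a , b , p , q , ab) →
                   x≢y ∘ sym , b , a , q , p , adj-sym G ab
  ; adj-irrefl = λ x≡y (x≢y , _) → x≢y x≡y
  }
  where f = merge u v (λ v≡u → adj-irrefl G (sym v≡u) e)

-- H ≼ G reads "H is a minor of G".
data _≼_ {h : ℕ} (H : Graph h) : ∀ {n} → Graph n → Set₁ where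
  isomorphic    : ∀ {n} {G : Graph n} → H ≅ G → H ≼ G
  delete-vertex : ∀ {n} {G : Graph (suc n)} v → H ≼ deleteVertex G v → H ≼ G
  delete-edge   : ∀ {n} {G : Graph n} u v → Adj G u v →
                  H ≼ deleteEdge G u v → H ≼ G
  contract-edge : ∀ {n} {G : Graph (suc n)} u v (e : Adj G u v) →
                  H ≼ contractEdge G u v e → H ≼ G

MinorFree : ∀ {h n} → Graph h → Graph n → Set₁
MinorFree H G = ¬ (H ≼ G)

Step : ∀ {n} → Graph n → Rel (Fin n) 0ℓ
Step G x y = x ≡ y ⊎ Adj G x y

-- A strategy sends the list of robber positions seen so far, latest first, to
-- the current cop positions: `position []` is the initial placement and
-- `position (r ∷ rs)` is where the cops go in reply to the robber reaching r.
record CopStrategy {n} (G : Graph n) (m : ℕ) : Set where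
  field
    position : List (Fin n) → Fin m → Fin n
    legal    : ∀ r rs i → Step G (position rs i) (position (r ∷ rs) i)

open CopStrategy public

RobberPlay : ∀ {n} → Graph n → (ℕ → Fin n) → Set
RobberPlay G ρ = ∀ k → Step G (ρ k) (ρ (suc k))

history : ∀ {n} → (ℕ → Fin n) → ℕ → List (Fin n)
history ρ zero    = []
history ρ (suc k) = ρ k ∷ history ρ k

-- While the robber is at ρ k, the cops are first at `position (history ρ k)`
-- and, after their next turn, at `position (history ρ (suc k))`; capture may
-- happen by either player's move.
Captures : ∀ {n m} {G : Graph n} → CopStrategy G m → (ℕ → Fin n) → Set
Captures σ ρ = ∃[ k ] ∃[ i ]
  (position σ (history ρ k) i ≡ ρ k ⊎ position σ (history ρ (suc k)) i ≡ ρ k)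

CopsWin : ∀ {n} → Graph n → ℕ → Set
CopsWin {n} G m =
  ∃[ σ ] ((ρ : ℕ → Fin n) → RobberPlay G ρ → Captures {m = m} {G} σ ρ)

IsCopNumber : ∀ {n} → Graph n → ℕ → Set
IsCopNumber G c = CopsWin G c × (∀ m → CopsWin G m → c ≤ m)

{-# OPTIONS --safe #-}
module Submission where

-- The robber's territory R is kept connected, and its neighbours lie on disjoint
-- paths joining two connected hubs A and B outside R, or are one of two hub vertices
-- a ∈ A, b ∈ B. Each path is guarded by its own cop, a and b by one of these, and
-- some cop f is free. First make a and b adjacent to R, by moving into the hubs the
-- initial or final vertices of a path. Then f guards a shortest a–b path Q through R:
-- it follows the shadow of the robber's distance from a. The robber is left with a
-- component R′ of R ∖ Q. If the interior of Q and all other paths now had neighbours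
-- in R′, there would be t of them, and with A, B and R′ they would form a K₃,ₜ minor.
-- So some path is not needed any more: if it is Q, return to the old paths with R′ for
-- R; otherwise its cop becomes free, as Q also guards a and b. If R has only one
-- neighbour x, guard an edge from x into R and start over with the hubs as its ends.

open import Defs
open import Data.Bool using (Bool; true; false)
open import Data.Fin
  using (Fin; zero; suc; toℕ; _≟_; combine; remQuot; finToFun; funToFin; punchIn; punchOut)
open import Data.Fin.Properties
  using (any?; all?; pigeonhole; ¬∀⟶∃¬; remQuot-combine; finToFun-funToFin;
         punchIn-punchOut; punchInᵢ≢i; punchIn-injective)
open import Data.List
  using (List; []; _∷_; _∷ʳ_; reverse; length; filter; applyUpTo; allFin; cartesianProduct)
open import Data.List.Membership.Propositional using (_∈_; _∉_; find; lose)
open import Data.List.Membership.Propositional.Properties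
  using (∈-allFin; ∈-cartesianProduct⁺; ∈-applyUpTo⁺; ∈-applyUpTo⁻; ∈-filter⁺)
import Data.List.Membership.DecPropositional as DecMembership
open import Data.List.Properties using (unfold-reverse; filter-notAll; length-tabulate)
open import Data.List.Relation.Binary.Permutation.Propositional using (↭-sym; ↭⇒↭ₛ)
open import Data.List.Relation.Binary.Permutation.Propositional.Properties using (↭-reverse)
import Data.List.Relation.Binary.Permutation.Setoid.Properties as Permutation
open import Data.List.Relation.Unary.All using (lookup)
open import Data.List.Relation.Unary.AllPairs using ([]; _∷_)
open import Data.List.Relation.Unary.Any as Any using (Any; here; there)
open import Data.List.Relation.Unary.Any.Properties using (reverse⁺; reverse⁻)
open import Data.List.Relation.Unary.Unique.Propositional using (Unique)
import Data.List.Relation.Unary.Unique.Propositional.Properties as Unique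
open import Data.Maybe using (Maybe; just; nothing)
open import Data.Maybe.Properties using (just-injective; ≡-dec)
open import Data.Nat
  using (ℕ; zero; suc; _+_; _*_; _^_; _⊓_; _≤_; _<_; z≤n; s≤s; _≤?_; _≤′_; ≤′-refl; ≤′-step)
open import Data.Nat.Properties hiding (_≟_; ≡-irrelevant)
open import Data.Product using (Σ; _×_; _,_; ∃; ∃-syntax; proj₁; proj₂)
open import Data.Sum using (_⊎_; inj₁; inj₂)
open import Data.Vec.Functional using (updateAt)
open import Data.Vec.Functional.Properties using (updateAt-updates; updateAt-minimal)
open import Function using (_∘_; const; mk⇔; mk↔ₛ′)
open import Relation.Binary.Construct.Closure.ReflexiveTransitive using (Star; ε; _◅_; _◅◅_; map)
  renaming (reverse to reverse⋆)
open import Relation.Binary.Definitions using (tri<; tri≈; tri>)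
open import Relation.Binary.PropositionalEquality
  using (_≡_; _≢_; _≗_; refl; sym; trans; cong; subst; subst₂; setoid)
open import Relation.Nullary using (¬_; Dec; yes; no; ¬?; contradiction; _×-dec_; _⊎-dec_; _→-dec_)
open import Relation.Nullary.Decidable using (map′; decidable-stable)
open import Relation.Unary using (Decidable; _⊆_)

-- Every round takes a vertex out of the territory: the path `Q` is made to have an interior vertex,
-- and the edge of a restart has an end in the territory. `winning` is therefore an induction on a
-- bound for the size of the territory. While the free cop travels, the old guards stay in force.
-- Enlarging the hubs beforehand is harmless, because it keeps the territory and only shortens
-- paths. If `Q` is given up, its ends lose the only cop known to guard both, whereas cop `q` still
-- guards the old `a` and `b`. This is why the old paths, and not the shortened ones, are restored.
-- A shortest path inside the territory suffices for guarding, as only distances between positions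
-- of a robber who stays there are compared. At least two cops are required so that one can hold
-- while another is free. The cop number is a minimum, so its existence takes more than a winning
-- strategy for `t` cops: the game is first shown to be decidable, as a fixed point on finitely many
-- positions.

-- Least witnesses and growing families of finite sets

least : ∀ {P : ℕ → Set} → Decidable P → ∀ k → P k → ∃[ m ] (P m × (∀ j → P j → m ≤ j))
least P? zero pk = zero , pk , λ _ _ → z≤n
least P? (suc k) pk with P? zero
... | yes p0 = zero , p0 , λ _ _ → z≤n
... | no ¬p0 with m , pm , m-least ← least (P? ∘ suc) k pk =
  suc m , pm , λ { zero p0 → contradiction p0 ¬p0 ; (suc j) pj → s≤s (m-least j pj) }

-- If each of the first `M + 1` steps added an element, two of them would add the same one, although
-- an element stays once it is in.
stabilises : ∀ {M} {W : ℕ → Fin M → Set} → (∀ k → Decidable (W k)) →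
             (∀ {k v} → W k v → W (suc k) v) →
             ∃[ k ] (∀ v → W (suc k) v → W k v)
stabilises {M} {W} W? grow
  with any? {n = suc M} (λ k → all? λ v → W? (suc (toℕ k)) v →-dec W? (toℕ k) v)
... | yes (k , stable) = toℕ k , stable
... | no unstable = contradiction (later i<j (subst (W _) xᵢ≡xⱼ (fresh i .proj₂ .proj₁)))
                                  (fresh j .proj₂ .proj₂)
  where
  fresh : ∀ (k : Fin (suc M)) → ∃[ v ] (W (suc (toℕ k)) v × ¬ W (toℕ k) v)
  fresh k with ¬∀⟶∃¬ M _ (λ v → W? (suc (toℕ k)) v →-dec W? (toℕ k) v) (λ s → unstable (k , s))
  ... | v , ¬s = v , decidable-stable (W? _ v) (λ ¬w → ¬s λ w → contradiction w ¬w) ,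
                 λ w → ¬s (const w)
  later′ : ∀ {i j v} → i ≤′ j → W i v → W j v
  later′ ≤′-refl w = w
  later′ (≤′-step i≤j) w = grow (later′ i≤j w)
  later : ∀ {i j v} → i < j → W (suc i) v → W j v
  later = later′ ∘ ≤⇒≤′
  collision = pigeonhole (n<1+n M) (proj₁ ∘ fresh)
  i = collision .proj₁
  j = collision .proj₂ .proj₁
  i<j = collision .proj₂ .proj₂ .proj₁
  xᵢ≡xⱼ = collision .proj₂ .proj₂ .proj₂

-- Solving the game

module Game {n : ℕ} (G : Graph n) where

  step? : ∀ x y → Dec (Step G x y)
  step? x y = (x ≟ y) ⊎-dec adj? G x y

  -- At c and r it is the cops' turn.
  data Win {m} (c : Fin m → Fin n) (r : Fin n) : Set where
    grab    : ∀ i → Step G (c i) r → Win c r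
    advance : ∀ c′ → (∀ i → Step G (c i) (c′ i)) → (∀ r′ → Step G r r′ → Win c′ r′) → Win c r

  module _ {m : ℕ} where

    private
      Cops = Fin m → Fin n

    -- Cop placements are quantified over as codes in Fin (n ^ m), for decidability.
    Level : ℕ → Cops → Fin n → Set
    Level zero    c r = ∃[ i ] Step G (c i) r
    Level (suc k) c r = Level k c r ⊎
      ∃[ κ ] ((∀ i → Step G (c i) (finToFun {n} {m} κ i)) ×
              (∀ r′ → Step G r r′ → Level k (finToFun κ) r′))

    level? : ∀ k c r → Dec (Level k c r)
    level? zero    c r = any? λ i → step? (c i) r
    level? (suc k) c r = level? k c r ⊎-dec any? λ κ →
      all? (λ i → step? (c i) (finToFun κ i)) ×-dec
      all? (λ r′ → step? r r′ →-dec level? k (finToFun κ) r′)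

    -- Decoding the code of a placement returns it only up to pointwise equality, along which levels
    -- must be transported.
    level-resp : ∀ k {c d r} → c ≗ d → Level k c r → Level k d r
    level-resp zero c≗d (i , s) = i , subst (λ x → Step G x _) (c≗d i) s
    level-resp (suc k) c≗d (inj₁ l) = inj₁ (level-resp k c≗d l)
    level-resp (suc k) c≗d (inj₂ (κ , legal , l)) =
      inj₂ (κ , (λ i → subst (λ x → Step G x _) (c≗d i) (legal i)) , l)

    level⇒win : ∀ k {c r} → Level k c r → Win c r
    level⇒win zero (i , s) = grab i s
    level⇒win (suc k) (inj₁ l) = level⇒win k l
    level⇒win (suc k) (inj₂ (κ , legal , l)) =
      advance (finToFun κ) legal λ r′ s → level⇒win k (l r′ s)

    grab-level : ∀ k {c r} i → Step G (c i) r → Level k c r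
    grab-level zero i s = i , s
    grab-level (suc k) i s = inj₁ (grab-level k i s)

    stableLevel : ∃[ k ] (∀ c r → Level (suc k) c r → Level k c r)
    stableLevel with stabilises {n ^ m * n}
                       {λ k v → Level k (finToFun (proj₁ (remQuot n v))) (proj₂ (remQuot {n ^ m} n v))}
                       (λ k v → level? k _ _) inj₁
    ... | k , stable = k , λ c r l →
      level-resp k (finToFun-funToFin c)
        (subst (λ (κ , r) → Level k (finToFun κ) r) (remQuot-combine (funToFin c) r)
          (stable (combine (funToFin c) r)
            (subst (λ (κ , r) → Level (suc k) (finToFun κ) r) (sym (remQuot-combine (funToFin c) r))
              (level-resp (suc k) (sym ∘ finToFun-funToFin c) l))))

    -- By induction all replies lie in one and the same stable level, so the position lies in the
    -- next level, which is no larger.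
    win⇒level : ∀ {c r} → Win c r → Level (proj₁ stableLevel) c r
    win⇒level (grab i s) = grab-level _ i s
    win⇒level {c} {r} (advance c′ legal w) = proj₂ stableLevel c r
      (inj₂ (funToFin c′ ,
             (λ i → subst (Step G (c i)) (sym (finToFun-funToFin c′ i)) (legal i)) ,
             λ r′ s → level-resp _ (sym ∘ finToFun-funToFin c′) (win⇒level (w r′ s))))

    win? : ∀ c r → Dec (Win c r)
    win? c r = map′ (level⇒win _) win⇒level (level? _ c r)

    -- `nothing` stands for having won, or for an illegal move of the robber.
    Plan : Cops → Set
    Plan c = ∀ r → Maybe (Win c r)

    resume : ∀ {c′ r} → (∀ r′ → Step G r r′ → Win c′ r′) → Plan c′
    resume {r = r} w r′ with step? r r′
    ... | yes s = just (w r′ s)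
    ... | no _  = nothing

    respond : ∀ {c r} → Maybe (Win c r) → ∃ Plan
    respond {c} nothing = c , λ _ → nothing
    respond {c} {r} (just (grab i s)) = updateAt c i (const r) , λ _ → nothing
    respond (just (advance c′ legal w)) = c′ , resume w

    respond-legal : ∀ {c r} (w : Maybe (Win c r)) i → Step G (c i) (proj₁ (respond w) i)
    respond-legal nothing i = inj₁ refl
    respond-legal {c} {r} (just (grab j s)) i with i ≟ j
    ... | yes refl = subst (Step G (c i)) (sym (updateAt-updates i c)) s
    ... | no i≢j   = inj₁ (sym (updateAt-minimal i j c i≢j))
    respond-legal (just (advance c′ legal w)) = legal

    module _ (c₀ : Cops) (win : ∀ r → Win c₀ r) where

      plan : List (Fin n) → ∃ Plan
      plan []       = c₀ , just ∘ win
      plan (r ∷ rs) = respond (proj₂ (plan rs) r)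

      follow : CopStrategy G m
      follow .position = proj₁ ∘ plan
      follow .legal r rs = respond-legal (proj₂ (plan rs) r)

      module _ (ρ : ℕ → Fin n) (play : RobberPlay G ρ) where

        -- Recursion on the tree `w`, whose well-foundedness takes the place of a bound on the
        -- length of the play. The equations say that `w` is what the strategy has in store after
        -- this history.
        capture : ∀ k {c} {p : Plan c} (w : Win c (ρ k)) →
                  plan (history ρ k) ≡ (c , p) → p (ρ k) ≡ just w → Captures follow ρ
        capture k (grab i s) eq peq = k , i , inj₂ (helper eq peq)
          where
          helper : ∀ {c s} {st : ∃ Plan} {p : Plan c} → st ≡ (c , p) →
                   p (ρ k) ≡ just (grab i s) →
                   proj₁ (respond (proj₂ st (ρ k))) i ≡ ρ k
          helper {c} refl peq rewrite peq = updateAt-updates i c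
        capture k (advance c′ l w) eq peq with step? (ρ k) (ρ (suc k)) in seq
        ... | no ¬s = contradiction (play k) ¬s
        ... | yes s = capture (suc k) (w (ρ (suc k)) s) (helper eq peq) resumed
          where
          helper : ∀ {c l} {st : ∃ Plan} {p : Plan c} → st ≡ (c , p) →
                   p (ρ k) ≡ just (advance c′ l w) →
                   respond (proj₂ st (ρ k)) ≡ (c′ , resume w)
          helper refl peq rewrite peq = refl
          resumed : resume w (ρ (suc k)) ≡ just (w (ρ (suc k)) s)
          resumed rewrite seq = refl

      win⇒copsWin : CopsWin G m
      win⇒copsWin = follow , λ ρ play → capture ρ play 0 (win (ρ 0)) refl refl

    module _ (safe : ∀ (c : Cops) → ∃[ r ] ¬ Win c r) (σ : CopStrategy G m) where

      -- If every reply were lost for the robber, `advance c′` would have won already; decidability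
      -- of `Win` turns this into an actual reply.
      dodge : ∀ {c r} → ¬ Win {m} c r → ∀ c′ → (∀ i → Step G (c i) (c′ i)) →
                        ∃[ r′ ] (Step G r r′ × ¬ Win c′ r′)
      dodge {c} {r} ¬w c′ legal
        with any? (λ r′ → step? r r′ ×-dec ¬? (win? c′ r′))
      ... | yes e = e
      ... | no ¬e = contradiction
        (advance c′ legal λ r′ s → decidable-stable (win? c′ r′) λ ¬w′ → ¬e (r′ , s , ¬w′)) ¬w

      Evading : Set
      Evading = ∃[ rs ] ∃[ r ] ¬ Win (position σ rs) r

      escape : (e@(rs , r , _) : Evading) →
               ∃[ r′ ] (Step G r r′ × ¬ Win (position σ (r ∷ rs)) r′)
      escape (rs , r , ¬w) = dodge ¬w (position σ (r ∷ rs)) (legal σ r rs)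

      evade : ℕ → Evading
      evade zero    = [] , safe (position σ [])
      evade (suc k) = prolong (evade k)
        where
        prolong : Evading → Evading
        prolong e@(rs , r , _) = r ∷ rs , proj₁ (escape e) , proj₂ (proj₂ (escape e))

      ρ : ℕ → Fin n
      ρ k = evade k .proj₂ .proj₁

      ρ-legal : RobberPlay G ρ
      ρ-legal k = escape (evade k) .proj₂ .proj₁

      ρ-history : ∀ k → history ρ k ≡ evade k .proj₁
      ρ-history zero = refl
      ρ-history (suc k) = cong (ρ k ∷_) (ρ-history k)

      -- Both kinds of capture are a `grab` from a position that is not won: the cop stays where it
      -- is, or makes its legal move.
      ¬captures : ¬ Captures σ ρ
      ¬captures (k , i , caught) rewrite ρ-history k with evade k | caught
      ... | rs , r , ¬w | inj₁ c≡r = ¬w (grab i (inj₁ c≡r))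
      ... | rs , r , ¬w | inj₂ c≡r = ¬w (grab i (subst (Step G _) c≡r (legal σ r rs i)))

    copsWin? : Dec (CopsWin G m)
    copsWin? with any? {n = n ^ m} (λ κ → all? λ r → win? (finToFun κ) r)
    ... | yes (κ , w) = yes (win⇒copsWin (finToFun κ) w)
    ... | no ¬w = no λ (σ , wins) → ¬captures safe σ (wins (ρ safe σ) (ρ-legal safe σ))
      where
      safe : ∀ c → ∃[ r ] ¬ Win c r
      safe c =
        let r , ¬l = ¬∀⟶∃¬ n _ (level? (proj₁ stableLevel) c) λ l →
              ¬w (funToFin c , λ r → level⇒win _ (level-resp _ (sym ∘ finToFun-funToFin c) (l r)))
        in r , ¬l ∘ win⇒level

  copNumber≤ : ∀ {t} → CopsWin G t → ∃[ c ] (IsCopNumber G c × c ≤ t)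
  copNumber≤ {t} wins with least (λ m → copsWin? {m}) t wins
  ... | c , winsᶜ , c-least = c , (winsᶜ , c-least) , c-least t wins

-- Minors from branch sets

module _ {h} {H : Graph h} where

  -- Recursion on `ps`, which always contains the edges that `G` has beyond those of `H`. When the
  -- pair of such an edge comes up, the edge is deleted.
  spanning⇒≼ : ∀ {n} {G : Graph n} (ι : Fin h → Fin n) (π : Fin n → Fin h) →
                (∀ x → π (ι x) ≡ x) → (∀ v → ι (π v) ≡ v) →
                (∀ {x y} → Adj H x y → Adj G (ι x) (ι y)) →
                (ps : List (Fin n × Fin n)) →
                (∀ u v → Adj G u v → ¬ Adj H (π u) (π v) → (u , v) ∈ ps) →
                H ≼ G
  spanning⇒≼ {n} {G} ι π πι ιπ hom [] extra = isomorphic record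
    { vertices = mk↔ₛ′ ι π ιπ πι
    ; edges = λ x y → mk⇔ hom λ e →
        decidable-stable (adj? H x y) λ ¬e →
        contradiction (extra (ι x) (ι y) e (¬e ∘ subst (λ (x , y) → Adj H x y) (πι² x y))) λ ()
    }
    where
    πι² : ∀ x y → (π (ι x) , π (ι y)) ≡ (x , y)
    πι² x y rewrite πι x | πι y = refl
  spanning⇒≼ {n} {G} ι π πι ιπ hom ((u , v) ∷ ps) extra
    with adj? G u v ×-dec ¬? (adj? H (π u) (π v))
  ... | no ¬extra = spanning⇒≼ ι π πι ιπ hom ps λ x y e ¬e → rest e ¬e (extra x y e ¬e)
    where
    rest : ∀ {x y} → Adj G x y → ¬ Adj H (π x) (π y) → (x , y) ∈ (u , v) ∷ ps → (x , y) ∈ ps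
    rest e ¬e (here refl) = contradiction (e , ¬e) ¬extra
    rest e ¬e (there p) = p
  ... | yes (uv , ¬uv) = delete-edge u v uv
    (spanning⇒≼ ι π πι ιπ (λ e → hom e , kept e) ps λ x y (e , ne) ¬e → rest ne (extra x y e ¬e))
    where
    kept : ∀ {x y} → Adj H x y → ¬ SamePair u v (ι x) (ι y)
    kept {x} {y} e (inj₁ (refl , refl)) rewrite πι x | πι y = ¬uv e
    kept {x} {y} e (inj₂ (refl , refl)) rewrite πι x | πι y = ¬uv (adj-sym H e)
    rest : ∀ {x y} → ¬ SamePair u v x y → (x , y) ∈ (u , v) ∷ ps → (x , y) ∈ ps
    rest ne (here refl) = contradiction (inj₁ (refl , refl)) ne
    rest ne (there p) = p

  Inside : ∀ {n} → Graph n → (Fin n → Maybe (Fin h)) → Fin h → Fin n → Fin n → Set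
  Inside G μ x u v = Adj G u v × μ u ≡ just x × μ v ≡ just x

  -- The fibres of `μ` are the branch sets of a minor, and `nothing` marks vertices to be deleted.
  -- The roots make the branch sets nonempty and are where connecting walks end.
  record Model {n} (G : Graph n) : Set where
    field
      μ         : Fin n → Maybe (Fin h)
      root      : Fin h → Fin n
      μ-root    : ∀ x → μ (root x) ≡ just x
      connected : ∀ {x v} → μ v ≡ just x → Star (Inside G μ x) v (root x)
      edge      : ∀ {x y} → Adj H x y → ∃[ u ] ∃[ v ] (μ u ≡ just x × μ v ≡ just y × Adj G u v)

  open Model

  dropUnused : ∀ {n} {G : Graph (suc n)} (M : Model G) v → μ M v ≡ nothing →
               Model (deleteVertex G v)
  dropUnused {n} {G} M v unused = record
    { μ = μ M ∘ punchIn v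
    ; root = λ x → lower (μ-root M x)
    ; μ-root = λ x → trans (cong (μ M) (punchIn-punchOut _)) (μ-root M x)
    ; connected = λ p → walk refl (punchIn-punchOut _) p (connected M p)
    ; edge = λ e → let a , b , p , q , ab = edge M e in
        lower p , lower q , lowered p , lowered q , lowerEdge p q ab
    }
    where
    used : ∀ {w x} → μ M w ≡ just x → v ≢ w
    used p refl with trans (sym unused) p
    ... | ()
    lower : ∀ {w x} → μ M w ≡ just x → Fin n
    lower p = punchOut (used p)
    lowered : ∀ {w x} (p : μ M w ≡ just x) → μ M (punchIn v (lower p)) ≡ just x
    lowered p = trans (cong (μ M) (punchIn-punchOut (used p))) p
    lowerEdge : ∀ {a b x y} (p : μ M a ≡ just x) (q : μ M b ≡ just y) → Adj G a b →
                Adj G (punchIn v (lower p)) (punchIn v (lower q))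
    lowerEdge p q e rewrite punchIn-punchOut (used p) | punchIn-punchOut (used q) = e
    walk : ∀ {x a b a′ b′} → punchIn v a′ ≡ a → punchIn v b′ ≡ b → μ M a ≡ just x →
           Star (Inside G (μ M) x) a b → Star (Inside (deleteVertex G v) (μ M ∘ punchIn v) x) a′ b′
    walk {a′ = a′} {b′} refl eq _ ε with punchIn-injective v b′ a′ eq
    ... | refl = ε
    walk refl eq p ((e , _ , q) ◅ es) =
      (subst (Adj G _) (sym at) e , p , lowered q) ◅ walk at eq q es
      where at = punchIn-punchOut (used q)

  contractInside : ∀ {n} {G : Graph (suc n)} (M : Model G) u v (e : Adj G u v) →
                   μ M u ≡ μ M v → Model (contractEdge G u v e)
  contractInside {n} {G} M u v e same = record
    { μ = μ′
    ; root = f ∘ root M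
    ; μ-root = λ x → trans (μ′-f _) (μ-root M x)
    ; connected = λ {x} {w} p →
        subst (λ w → Star (Inside G′ μ′ x) w (f (root M x))) (f-punchIn w) (walk (connected M p))
    ; edge = λ h → let a , b , p , q , ab = edge M h in
        f a , f b , trans (μ′-f a) p , trans (μ′-f b) q ,
        (λ eq → adj-irrefl H (just-injective
          (trans (sym (trans (μ′-f a) p)) (trans (cong μ′ eq) (trans (μ′-f b) q)))) h) ,
        a , b , refl , refl , ab
    }
    where
    v≢u : v ≢ u
    v≢u = λ v≡u → adj-irrefl G (sym v≡u) e
    f = merge u v v≢u
    G′ = contractEdge G u v e
    μ′ = μ M ∘ punchIn v
    μ′-f : ∀ x → μ′ (f x) ≡ μ M x
    μ′-f x with v ≟ x
    ... | yes refl = trans (cong (μ M) (punchIn-punchOut v≢u)) same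
    ... | no v≢x   = cong (μ M) (punchIn-punchOut v≢x)
    f-punchIn : ∀ w → f (punchIn v w) ≡ w
    f-punchIn w with v ≟ punchIn v w
    ... | yes eq = contradiction (sym eq) (punchInᵢ≢i v w)
    ... | no v≢x = punchIn-injective v _ _ (punchIn-punchOut v≢x)
    walk : ∀ {x a b} → Star (Inside G (μ M) x) a b → Star (Inside G′ μ′ x) (f a) (f b)
    walk ε = ε
    walk {x} {a} {b} (_◅_ {j = c} (ac , p , q) es) with f a ≟ f c
    -- An edge whose ends get identified is skipped in the contracted walk.
    ... | yes fa≡fc = subst (λ w → Star (Inside G′ μ′ x) w (f b)) (sym fa≡fc) (walk es)
    ... | no fa≢fc  =
      ((fa≢fc , a , c , refl , refl , ac) , trans (μ′-f a) p , trans (μ′-f c) q) ◅ walk es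

  -- Each deletion or contraction lowers the number of vertices. When none applies, all walks to
  -- roots are empty, so branch sets are single vertices and only surplus edges remain.
  model⇒≼ : ∀ {n} {G : Graph n} → Model G → H ≼ G
  model⇒≼ {n} {G} M with any? (λ v → ≡-dec _≟_ (μ M v) nothing)
  model⇒≼ {suc n} {G} M | yes (v , unused) = delete-vertex v (model⇒≼ (dropUnused M v unused))
  model⇒≼ {n} {G} M | no allUsed
    with any? (λ u → any? λ v → adj? G u v ×-dec ≡-dec _≟_ (μ M u) (μ M v))
  model⇒≼ {suc n} {G} M | no allUsed | yes (u , v , e , same) =
    contract-edge u v e (model⇒≼ (contractInside M u v e same))
  ... | no noInside = spanning⇒≼ (root M) π (λ x → just-injective (trans (sym (μπ _)) (μ-root M x)))
                        (λ v → sym (isRoot (μπ v))) hom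
                        (cartesianProduct (allFin n) (allFin n))
                        λ u v _ _ → ∈-cartesianProduct⁺ (∈-allFin u) (∈-allFin v)
    where
    total : ∀ v → ∃[ x ] μ M v ≡ just x
    total v with μ M v in eq
    ... | just x  = x , refl
    ... | nothing = contradiction (v , eq) allUsed
    π = proj₁ ∘ total
    μπ = proj₂ ∘ total
    isRoot : ∀ {x v} → μ M v ≡ just x → v ≡ root M x
    isRoot p with connected M p
    ... | ε = refl
    ... | (e , q , q′) ◅ _ = contradiction (_ , _ , e , trans q (sym q′)) noInside
    hom : ∀ {x y} → Adj H x y → Adj G (root M x) (root M y)
    hom e with a , b , p , q , ab ← edge M e with refl ← isRoot p | refl ← isRoot q = ab

-- Guarding shortest paths

module Geodesics {n : ℕ} (G : Graph n) where

  Within : (Fin n → Set) → Fin n → Fin n → Set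
  Within T u v = Adj G u v × T u × T v

  record Component (T : Fin n → Set) (r : Fin n) : Set₁ where
    field
      C        : Fin n → Set
      C?       : Decidable C
      base     : C r
      inside   : ∀ {v} → C v → T v
      closed   : ∀ {u v} → T u → C v → Adj G u v → C u
      linked   : ∀ {v} → C v → Star (Within C) v r

  -- The edge condition makes the empty list a path only between adjacent sets.
  Path : (Fin n → Set) → List (Fin n) → (Fin n → Set) → Set
  Path X []       Y = ∃[ u ] ∃[ v ] (X u × Y v × Adj G u v)
  Path X (x ∷ xs) Y = (∃[ u ] (X u × Adj G u x)) × Path (_≡ x) xs Y

  path-applyUpTo : ∀ (f : ℕ → Fin n) m → (∀ j → j ≤ m → Adj G (f j) (f (suc j))) →
                   Path (_≡ f 0) (applyUpTo (f ∘ suc) m) (_≡ f (suc m))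
  path-applyUpTo f zero    adj = f 0 , f 1 , refl , refl , adj 0 z≤n
  path-applyUpTo f (suc m) adj = (f 0 , refl , adj 0 z≤n) ,
                                 path-applyUpTo (f ∘ suc) m λ j j≤m → adj (suc j) (s≤s j≤m)

  -- A cop walking along `line` so as to be at `line (pos r)` whenever the robber
  -- is at r ∈ T can answer every entry of the robber into X.
  record Sweep (T X : Fin n → Set) : Set where
    field
      line      : ℕ → Fin n
      line-step : ∀ j → Step G (line j) (line (suc j))
      pos       : Fin n → ℕ
      len       : ℕ
      pos≤len   : ∀ v → pos v ≤ len
      lipschitz : ∀ {u v} → T u → T v → Adj G u v → pos v ≤ suc (pos u)
      blocks    : ∀ {u s} → T u → X s → Adj G u s → Step G (line (pos u)) s
      hits      : ∀ {s} → T s → X s → line (pos s) ≡ s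

    shadow : Fin n → Fin n
    shadow = line ∘ pos

  step-sym : ∀ {x y} → Step G x y → Step G y x
  step-sym (inj₁ eq) = inj₁ (sym eq)
  step-sym (inj₂ e)  = inj₂ (adj-sym G e)

  line-near : ∀ {line : ℕ → Fin n} → (∀ j → Step G (line j) (line (suc j))) →
         ∀ {i j} → i ≤ suc j → j ≤ suc i → Step G (line i) (line j)
  line-near {line} st {i} {j} i≤ j≤ with <-cmp i j
  ... | tri< i<j _ _ = subst (λ k → Step G (line i) (line k)) (≤-antisym i<j j≤) (st i)
  ... | tri≈ _ refl _ = inj₁ refl
  ... | tri> _ _ j<i = subst (λ k → Step G (line k) (line j)) (≤-antisym j<i i≤) (step-sym (st j))

  extend : ℕ → (ℕ → Fin n) → Fin n → ℕ → Fin n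
  extend k p v j with j ≤? k
  ... | yes _ = p j
  ... | no _  = v

  module _ (k : ℕ) (p : ℕ → Fin n) (v : Fin n) where

    extend-≤ : ∀ {j} → j ≤ k → extend k p v j ≡ p j
    extend-≤ {j} j≤k with j ≤? k
    ... | yes _  = refl
    ... | no j≰k = contradiction j≤k j≰k

    extend-> : ∀ {j} → k < j → extend k p v j ≡ v
    extend-> {j} k<j with j ≤? k
    ... | yes j≤k = contradiction j≤k (<⇒≱ k<j)
    ... | no _    = refl

    extend-adj : (∀ j → j < k → Adj G (p j) (p (suc j))) → Adj G (p k) v →
                 ∀ j → j ≤ k → Adj G (extend k p v j) (extend k p v (suc j))
    extend-adj adj last j j≤k with m≤n⇒m<n∨m≡n j≤k
    ... | inj₁ j<k = subst₂ (Adj G) (sym (extend-≤ j≤k)) (sym (extend-≤ j<k)) (adj j j<k)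
    ... | inj₂ refl = subst₂ (Adj G) (sym (extend-≤ j≤k)) (sym (extend-> ≤-refl)) last

  module _ {T : Fin n → Set} (T? : Decidable T) (a : Fin n) where

    -- Only the centre may lie outside `T`. With centre in `T` the balls fill a component of `T`;
    -- with centre next to `T` they measure paths that run through `T` after their start.
    Ball : ℕ → Fin n → Set
    Ball zero    v = v ≡ a
    Ball (suc k) v = Ball k v ⊎ (T v × ∃[ u ] (Ball k u × Adj G u v))

    ball? : ∀ k → Decidable (Ball k)
    ball? zero    v = v ≟ a
    ball? (suc k) v = ball? k v ⊎-dec (T? v ×-dec any? λ u → ball? k u ×-dec adj? G u v)

    opaque

      radius : ∃[ k ] (∀ v → Ball (suc k) v → Ball k v)
      radius = stabilises ball? inj₁

    component : T a → Component T a
    component Ta with k , stable ← radius = record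
      { C = Ball k ; C? = ball? k ; base = whole 0 refl ; inside = inside k
      ; closed = λ Tu Cv e → stable _ (inj₂ (Tu , _ , Cv , adj-sym G e))
      ; linked = linked k
      }
      where
      whole : ∀ j {v} → Ball j v → Ball k v
      whole zero    refl = centre k
        where
        centre : ∀ k → Ball k a
        centre zero    = refl
        centre (suc k) = inj₁ (centre k)
      whole (suc j) (inj₁ b) = whole j b
      whole (suc j) (inj₂ (Tv , u , b , e)) = stable _ (inj₂ (Tv , u , whole j b , e))
      inside : ∀ j {v} → Ball j v → T v
      inside zero    refl = Ta
      inside (suc j) (inj₁ b) = inside j b
      inside (suc j) (inj₂ (Tv , _)) = Tv
      linked : ∀ j {v} → Ball j v → Star (Within (Ball k)) v a
      linked zero    refl = ε
      linked (suc j) (inj₁ b) = linked j b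
      linked (suc j) b′@(inj₂ (_ , u , b , e)) =
        (adj-sym G e , whole (suc j) b′ , whole j b) ◅ linked j b

    AtDistance : ℕ → Fin n → Set
    AtDistance k v = Ball k v × (∀ j → Ball j v → k ≤ j)

    atDistance-inside : ∀ {k v} → AtDistance (suc k) v → T v × ∃[ u ] (AtDistance k u × Adj G u v)
    atDistance-inside (inj₁ b , min) = contradiction (min _ b) 1+n≰n
    atDistance-inside (inj₂ (Tv , u , b , e) , min) =
      Tv , u , (b , λ j b′ → ≤-pred (min (suc j) (inj₂ (Tv , u , b′ , e)))) , e

    -- A shortest path, built from its last vertex backwards. The exact distance of each `p j` is
    -- what later makes the path free of repetitions and the shadow land on it.
    trace : ∀ k {v} → AtDistance k v →
            Σ (ℕ → Fin n) λ p → (p k ≡ v × (∀ j → j ≤ k → AtDistance j (p j)) ×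
                    (∀ j → j < k → Adj G (p j) (p (suc j))))
    trace zero {v} at = const v , refl , (λ { zero _ → at }) , λ _ ()
    trace (suc k) {v} at with _ , u , at-u , e ← atDistance-inside at
      with p , refl , at-p , adj ← trace k at-u =
      extend k p v , extend-> k p v ≤-refl , at′ , λ j j<k → extend-adj k p v adj e j (≤-pred j<k)
      where
      at′ : ∀ j → j ≤ suc k → AtDistance j (extend k p v j)
      at′ j j≤ with m≤n⇒m<n∨m≡n j≤
      ... | inj₁ j<  = subst (AtDistance j) (sym (extend-≤ k p v (≤-pred j<))) (at-p j (≤-pred j<))
      ... | inj₂ refl = subst (AtDistance j) (sym (extend-> k p v ≤-refl)) at

  record Geodesic (T : Fin n → Set) (a b : Fin n) : Set where
    field
      interior : List (Fin n)
      first    : ∃[ x ] x ∈ interior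
      inside   : ∀ {v} → v ∈ interior → T v
      distinct : Unique interior
      route    : Path (_≡ a) interior (_≡ b)
      sweep    : Sweep T (λ s → s ≡ a ⊎ s ≡ b ⊎ s ∈ interior)

  -- Shortest among the a–b paths whose interior lies in T; an edge ab is ignored.
  geodesic : ∀ {T} → Decidable T → ∀ {r} → (∀ {v} → T v → Star (Within T) v r) →
             ∀ {a b a′ b′} → ¬ T a → ¬ T b → T a′ → Adj G a a′ → T b′ → Adj G b′ b → Geodesic T a b
  geodesic {T} T? {r} linked {a} {b} {a′} {b′} ¬Ta ¬Tb Ta′ aa′ Tb′ b′b = record
    { interior = interior
    ; first = Q 1 , ∈-applyUpTo⁺ (Q ∘ suc) 0<m
    ; inside = λ p → let i , i<m , eq = ∈-applyUpTo⁻ (Q ∘ suc) p in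
        subst T (sym eq) (proj₁ (atDistance-inside T? a (Q-at (suc i) i<m)))
    ; distinct = Unique.applyUpTo⁺₁ (Q ∘ suc) m λ {i} {j} i<j j<m eq → contradiction
        (proj₂ (Q-at (suc j) j<m) (suc i) (subst (B (suc i)) eq (proj₁ (Q-at (suc i) (<-trans i<j j<m)))))
        (<⇒≱ (s≤s i<j))
    ; route = subst₂ (λ x y → Path (_≡ x) interior (_≡ y)) Q₀ Qₑ (path-applyUpTo Q m Q-adj)
    ; sweep = record
      { line = Q
      ; line-step = Q-step
      ; pos = pos
      ; len = suc m
      ; pos≤len = λ v → m⊓n≤n (d v) (suc m)
      ; lipschitz = λ Tu Tv e → ⊓-mono-≤ (d-lip Tu Tv e) (n≤1+n (suc m))
      ; blocks = blocks
      ; hits = hits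
      }
    }
    where
    B = Ball T? a

    expand : ∀ {k u v} → B k u → Star (Within T) u v → ∃[ j ] B j v
    expand b ε = _ , b
    expand b ((e , _ , Tv) ◅ es) = expand (inj₂ (Tv , _ , b , e)) es

    fromCentre : ∀ {v} → T v → ∃[ k ] B k v
    fromCentre Tv = expand (inj₂ (Ta′ , a , refl , aa′))
      (linked Ta′ ◅◅ reverse⋆ (λ (e , p , q) → adj-sym G e , q , p) (linked Tv))

    distance : ∀ v → ∃[ k ] (T v → AtDistance T? a k v)
    distance v with T? v
    -- The value 0 is a default; distances are asserted on `T` only.
    ... | no ¬Tv = 0 , λ Tv → contradiction Tv ¬Tv
    ... | yes Tv with k , bk ← fromCentre Tv with d , at ← least (λ k → ball? T? a k v) k bk =
      d , const at
    d = proj₁ ∘ distance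
    d-at : ∀ {v} → T v → AtDistance T? a (d v) v
    d-at = proj₂ (distance _)
    d-lip : ∀ {u v} → T u → T v → Adj G u v → d v ≤ suc (d u)
    d-lip Tu Tv e = proj₂ (d-at Tv) _ (inj₂ (Tv , _ , proj₁ (d-at Tu) , e))

    -- The path leaves `T` at a vertex `w` next to `b` as near to `a` as possible. Hence every
    -- vertex of `T` next to `b` has distance at least `m`, and its shadow is at `w` or `b`.
    Exit : ℕ → Set
    Exit k = ∃[ w ] (T w × Adj G w b × B k w)
    exit = least {Exit} (λ k → any? λ w → T? w ×-dec adj? G w b ×-dec ball? T? a k w) (d b′)
             (b′ , Tb′ , b′b , proj₁ (d-at Tb′))
    m = proj₁ exit
    w = proj₁ (proj₁ (proj₂ exit))
    Tw = proj₁ (proj₂ (proj₁ (proj₂ exit)))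
    wb = proj₁ (proj₂ (proj₂ (proj₁ (proj₂ exit))))
    Bw = proj₂ (proj₂ (proj₂ (proj₁ (proj₂ exit))))
    exit-least : ∀ {u k} → T u → Adj G u b → B k u → m ≤ k
    exit-least Tu ub bk = proj₂ (proj₂ exit) _ (_ , Tu , ub , bk)
    traced = trace T? a m {w} (Bw , λ _ → exit-least Tw wb)

    p = proj₁ traced
    Q = extend m p b
    Q-at : ∀ j → j ≤ m → AtDistance T? a j (Q j)
    Q-at j j≤m = subst (AtDistance T? a j) (sym (extend-≤ m p b j≤m))
                   (proj₁ (proj₂ (proj₂ traced)) j j≤m)
    Q-adj : ∀ j → j ≤ m → Adj G (Q j) (Q (suc j))
    Q-adj = extend-adj m p b (proj₂ (proj₂ (proj₂ traced)))
              (subst (λ x → Adj G x b) (sym (proj₁ (proj₂ traced))) wb)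
    Q₀ : Q 0 ≡ a
    Q₀ = proj₁ (Q-at 0 z≤n)
    Qₑ : Q (suc m) ≡ b
    Qₑ = extend-> m p b ≤-refl
    Q-step : ∀ j → Step G (Q j) (Q (suc j))
    Q-step j with ≤-<-connex j m
    ... | inj₁ j≤m = inj₂ (Q-adj j j≤m)
    ... | inj₂ m<j = inj₁ (trans (extend-> m p b m<j) (sym (extend-> m p b (m<n⇒m<1+n m<j))))

    interior = applyUpTo (Q ∘ suc) m
    -- At distance 0 there is only `a`, which is not in `T`. So the path is never a bare edge `ab`,
    -- and its interior is nonempty.
    0<m : 0 < m
    0<m = n≢0⇒n>0 λ m≡0 → ¬Ta (subst T (subst (λ k → B k w) m≡0 Bw) Tw)

    -- For a robber farther from `a` than `b` is along `Q`, the shadow waits on `b`, at index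
    -- `m + 1`.
    pos : Fin n → ℕ
    pos v = d v ⊓ suc m

    blocks : ∀ {u s} → T u → (s ≡ a ⊎ s ≡ b ⊎ s ∈ interior) → Adj G u s → Step G (Q (pos u)) s
    blocks {u} Tu (inj₁ refl) ua = subst (Step G _) Q₀ (line-near Q-step {pos u} {0}
      (≤-trans (m⊓n≤m (d u) _) (proj₂ (d-at Tu) 1 (inj₂ (Tu , a , refl , adj-sym G ua)))) z≤n)
    blocks {u} Tu (inj₂ (inj₁ refl)) ub = subst (Step G _) Qₑ (line-near Q-step {pos u} {suc m}
      (≤-trans (m⊓n≤n (d u) _) (n≤1+n _))
      (s≤s (⊓-glb (exit-least Tu ub (proj₁ (d-at Tu))) (n≤1+n m))))
    blocks {u} Tu (inj₂ (inj₂ s∈)) us with j , j<m , refl ← ∈-applyUpTo⁻ (Q ∘ suc) s∈ =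
      line-near Q-step {pos u} {suc j}
        (≤-trans (m⊓n≤m (d u) _) (proj₂ (d-at Tu) _ (inj₂ (Tu , _ , proj₁ at , adj-sym G us))))
        (s≤s (⊓-glb (≤-pred (proj₂ at _ (inj₂ (Ts , u , proj₁ (d-at Tu) , us))))
                    (≤-trans (<⇒≤ j<m) (n≤1+n m))))
      where
      at = Q-at (suc j) j<m
      Ts = proj₁ (atDistance-inside T? a at)

    hits : ∀ {s} → T s → (s ≡ a ⊎ s ≡ b ⊎ s ∈ interior) → Q (pos s) ≡ s
    hits Ta (inj₁ refl) = contradiction Ta ¬Ta
    hits Tb (inj₂ (inj₁ refl)) = contradiction Tb ¬Tb
    hits Ts (inj₂ (inj₂ s∈)) with j , j<m , refl ← ∈-applyUpTo⁻ (Q ∘ suc) s∈ =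
      cong Q (trans (m≤n⇒m⊓n≡m (subst (_≤ suc m) (sym ds≡) (≤-trans j<m (n≤1+n m)))) ds≡)
      where
      at = Q-at (suc j) j<m
      ds≡ : d (Q (suc j)) ≡ suc j
      ds≡ = ≤-antisym (proj₂ (d-at Ts) _ (proj₁ at)) (proj₂ at _ (proj₁ (d-at Ts)))

-- Paths between two hubs

-- `robber` marks the robber's territory, `path i` the path guarded by cop i.
data Label (t : ℕ) : Set where
  robber : Label t
  hub    : Bool → Label t
  path   : Fin t → Label t
  idle   : Label t

module Linkages {n : ℕ} (G : Graph n) (t : ℕ) where

  open Geodesics G public
  open DecMembership (_≟_ {n}) public using (_∈?_)

  Labelling = Fin n → Label t

  robber? : (ℓ : Label t) → Dec (ℓ ≡ robber)
  robber? robber   = yes refl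
  robber? (hub _)  = no λ ()
  robber? (path _) = no λ ()
  robber? idle     = no λ ()

  Own : Labelling → Label t → Fin n → Set
  Own own ℓ v = own v ≡ ℓ

  opaque

    relabel : ∀ {D : Fin n → Set} → Decidable D → Label t → Labelling → Labelling
    relabel D? ℓ own v with D? v
    ... | yes _ = ℓ
    ... | no _  = own v

  module _ {D : Fin n → Set} (D? : Decidable D) {ℓ : Label t} {own : Labelling} where

    opaque
      unfolding relabel

      relabel-yes : ∀ {v} → D v → relabel D? ℓ own v ≡ ℓ
      relabel-yes {v} d with D? v
      ... | yes _ = refl
      ... | no ¬d = contradiction d ¬d

      relabel-no : ∀ {v} → ¬ D v → relabel D? ℓ own v ≡ own v
      relabel-no {v} ¬d with D? v
      ... | yes d = contradiction d ¬d
      ... | no _  = refl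

      relabel⁻ : ∀ {v k} → relabel D? ℓ own v ≡ k → ℓ ≢ k → ¬ D v × own v ≡ k
      relabel⁻ {v} eq ℓ≢k with D? v
      ... | yes _ = contradiction eq ℓ≢k
      ... | no ¬d = ¬d , eq

    relabel-keeps : ∀ {v k} → (D v → own v ≢ k) → own v ≡ k → relabel D? ℓ own v ≡ k
    relabel-keeps avoids eq = trans (relabel-no λ d → avoids d eq) eq

  Frontier : Labelling → Fin n → Set
  Frontier own u = own u ≢ robber × ∃[ v ] (own v ≡ robber × Adj G v u)

  frontier? : ∀ own → Decidable (Frontier own)
  frontier? own u = ¬? (robber? (own u)) ×-dec any? λ v → robber? (own v) ×-dec adj? G v u

  within-sym : ∀ {T u v} → Within T u v → Within T v u
  within-sym (e , p , q) = adj-sym G e , q , p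

  path-mono : ∀ {X X′ Y Y′} → X ⊆ X′ → Y ⊆ Y′ → ∀ xs → Path X xs Y → Path X′ xs Y′
  path-mono f g []       (u , v , Xu , Yv , e) = u , v , f Xu , g Yv , e
  path-mono f g (x ∷ xs) ((u , Xu , e) , p) = (u , f Xu , e) , path-mono (λ eq → eq) g xs p

  path-reverse : ∀ {X Y} xs → Path X xs Y → Path Y (reverse xs) X
  path-reverse [] (u , v , Xu , Yv , e) = v , u , Yv , Xu , adj-sym G e
  path-reverse {X} {Y} (x ∷ xs) (e , p) =
    subst (λ ys → Path Y ys X) (sym (unfold-reverse x xs)) (snoc (reverse xs) (path-reverse xs p) e)
    where
    snoc : ∀ {Y} ys → Path Y ys (_≡ x) → ∃[ u ] (X u × Adj G u x) → Path Y (ys ∷ʳ x) X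
    snoc []       (u , _ , Yu , refl , ux) (w , Xw , wx) =
      (u , Yu , ux) , x , w , refl , Xw , adj-sym G wx
    snoc (y ∷ ys) (e , p) w = e , snoc ys p w

  path-last : ∀ {X Y} x xs → Path X (x ∷ xs) Y → ∃[ u ] ∃[ v ] (u ∈ x ∷ xs × Y v × Adj G u v)
  path-last x [] (_ , _ , v , refl , Yv , e) = x , v , here refl , Yv , e
  path-last x (y ∷ ys) (_ , p) with u , v , u∈ , Yv , e ← path-last y ys p = u , v , there u∈ , Yv , e

  path-linked : ∀ {X Y} x xs → Path X (x ∷ xs) Y → ∀ {v} → v ∈ x ∷ xs →
                Star (Within (_∈ x ∷ xs)) v x
  path-linked x xs _ (here refl) = ε
  path-linked x (y ∷ ys) (_ , p@((_ , refl , e) , _)) (there v∈) =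
    map (λ (e , p , q) → e , there p , there q) (path-linked y ys p v∈)
      ◅◅ (adj-sym G e , there (here refl) , here refl) ◅ ε

  -- Of the hub vertices only a and b may be next to the robber's territory.
  record Linkage (own : Labelling) (P : Fin t → List (Fin n)) (s s′ : Bool) (a b : Fin n) : Set where
    field
      s≢s′       : s ≢ s′
      path-label : ∀ {i v} → v ∈ P i → own v ≡ path i
      label-path : ∀ {i v} → own v ≡ path i → v ∈ P i
      unique     : ∀ i → Unique (P i)
      -- The first alternative means that there is no path `i`; on an empty list `Path` would demand
      -- an edge between the hubs.
      link       : ∀ i → P i ≡ [] ⊎ Path (Own own (hub s)) (P i) (Own own (hub s′))
      a-hub      : own a ≡ hub s
      b-hub      : own b ≡ hub s′
      a-linked   : ∀ {v} → own v ≡ hub s → Star (Within (Own own (hub s))) v a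
      b-linked   : ∀ {v} → own v ≡ hub s′ → Star (Within (Own own (hub s′))) v b
      cover      : ∀ {u} → Frontier own u → u ≡ a ⊎ u ≡ b ⊎ ∃[ i ] u ∈ P i

  open Linkage

  -- `touch` changes the first hub only; exchanging the hubs lets it serve for both. For this the
  -- hub labels are variables.
  flip : ∀ {own P s s′ a b} → Linkage own P s s′ a b → Linkage own (reverse ∘ P) s′ s b a
  flip {own} {P} {s} {s′} {a} {b} L = record
    { s≢s′ = s≢s′ L ∘ sym
    ; path-label = path-label L ∘ reverse⁻
    ; label-path = reverse⁺ ∘ label-path L
    ; unique = λ i → Permutation.Unique-resp-↭ (setoid _) (↭⇒↭ₛ (↭-sym (↭-reverse (P i)))) (unique L i)
    ; link = λ i → reversed (P i) (link L i)
    ; a-hub = b-hub L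
    ; b-hub = a-hub L
    ; a-linked = b-linked L
    ; b-linked = a-linked L
    ; cover = swapped ∘ cover L
    }
    where
    reversed : ∀ {X Y} xs → xs ≡ [] ⊎ Path X xs Y → reverse xs ≡ [] ⊎ Path Y (reverse xs) X
    reversed _  (inj₁ refl) = inj₁ refl
    reversed xs (inj₂ p)    = inj₂ (path-reverse xs p)
    swapped : ∀ {u} → u ≡ a ⊎ u ≡ b ⊎ ∃[ i ] u ∈ P i → u ≡ b ⊎ u ≡ a ⊎ ∃[ i ] u ∈ reverse (P i)
    swapped (inj₁ u≡a) = inj₂ (inj₁ u≡a)
    swapped (inj₂ (inj₁ u≡b)) = inj₁ u≡b
    swapped (inj₂ (inj₂ (i , u∈))) = inj₂ (inj₂ (i , reverse⁺ u∈))

  update-same : ∀ {A : Set} (P : Fin t → A) i {x} → updateAt P i (const x) i ≡ x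
  update-same P i = updateAt-updates i P

  update-other : ∀ {A : Set} (P : Fin t → A) {i j x} → j ≢ i → updateAt P i (const x) j ≡ P j
  update-other P {i} {j} j≢i = updateAt-minimal j i P j≢i

  updated : ∀ {A : Set} (R : Fin t → A → Set) {P : Fin t → A} {i xs} →
            R i xs → (∀ j → j ≢ i → R j (P j)) → ∀ j → R j (updateAt P i (const xs) j)
  updated R {P} {i} r rest j with j ≟ i
  ... | yes refl = subst (R i) (sym (update-same P i)) r
  ... | no j≢i   = subst (R j) (sym (update-other P j≢i)) (rest j j≢i)

  updated⁻ : ∀ {A : Set} (R : Fin t → A → Set) {P : Fin t → A} {i xs} j →
             R j (updateAt P i (const xs) j) →
             (j ≡ i × R i xs) ⊎ (j ≢ i × R j (P j))
  updated⁻ R {P} {i} j r with j ≟ i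
  ... | yes refl = inj₁ (refl , subst (R i) (update-same P i) r)
  ... | no j≢i   = inj₂ (j≢i , subst (R j) (update-other P j≢i) r)

  -- What keeps the old guards valid after a change of hubs: the territory is the same and no path
  -- gains a vertex.
  record Shrinks (own own′ : Labelling) (P P′ : Fin t → List (Fin n)) : Set where
    field
      robber⇒ : ∀ {v} → own v ≡ robber → own′ v ≡ robber
      robber⇐ : ∀ {v} → own′ v ≡ robber → own v ≡ robber
      paths   : ∀ {i v} → v ∈ P′ i → v ∈ P i

  open Shrinks

  frontier-resp : ∀ {own own′ P P′ u} → Shrinks own own′ P P′ → Frontier own u → Frontier own′ u
  frontier-resp S (u≢ , v , vr , e) = u≢ ∘ robber⇐ S , v , robber⇒ S vr , e

  shrinks-trans : ∀ {own own′ own″ P P′ P″} → Shrinks own own′ P P′ → Shrinks own′ own″ P′ P″ →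
                  Shrinks own own″ P P″
  shrinks-trans S S′ = record
    { robber⇒ = robber⇒ S′ ∘ robber⇒ S
    ; robber⇐ = robber⇐ S ∘ robber⇐ S′
    ; paths = paths S ∘ paths S′
    }

  -- The first vertex `x` of a path joins the hub, where it has a neighbour, and replaces `a`.
  -- Dropping `a` from `cover` is sound because `a` is not next to the territory.
  module Eat {own P s s′ a b} (L : Linkage own P s s′ a b) (¬a : ¬ Frontier own a)
             {i x xs} (Pi : P i ≡ x ∷ xs) where

    own′ : Labelling
    own′ = relabel (_≟ x) (hub s) own

    P′ : Fin t → List (Fin n)
    P′ = updateAt P i (const xs)

    x-path : own x ≡ path i
    x-path = path-label L (subst (x ∈_) (sym Pi) (here refl))

    P′⊆P : ∀ {j v} → v ∈ P′ j → v ∈ P j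
    P′⊆P {j} {v} = updated (λ j ys → v ∈ ys → v ∈ P j)
      (λ v∈ → subst (v ∈_) (sym Pi) (there v∈)) (λ _ _ v∈ → v∈) j

    x∉ : ∀ {v} → v ∈ xs → v ≢ x
    x∉ v∈ refl with p ∷ _ ← subst Unique Pi (unique L i) = lookup p v∈ refl

    keep : ∀ {v k} → path i ≢ k → own v ≡ k → own′ v ≡ k
    keep i≢k = relabel-keeps (_≟ x) λ { refl eq → i≢k (trans (sym x-path) eq) }

    first : (∃[ w ] (own w ≡ hub s × Adj G w x)) ×
            (xs ≡ [] ⊎ Path (Own own′ (hub s)) xs (Own own′ (hub s′)))
    first with link L i
    ... | inj₁ empty with () ← trans (sym Pi) empty
    ... | inj₂ p with e , p ← subst (λ ys → Path _ ys _) Pi p =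
      e , inj₂ (path-mono (λ { refl → relabel-yes (_≟ x) refl }) (keep λ ()) xs p)

    a-joined : ∀ {v} → own′ v ≡ hub s → Star (Within (Own own′ (hub s))) v x
    a-joined {v} eq with v ≟ x
    ... | yes refl = ε
    ... | no v≢x with (w , hw , wx) , _ ← first =
      map (λ (e , p , q) → e , keep (λ ()) p , keep (λ ()) q)
        (a-linked L (trans (sym (relabel-no (_≟ x) v≢x)) eq) ◅◅ reverse⋆ within-sym (a-linked L hw))
      ◅◅ (wx , keep (λ ()) hw , relabel-yes (_≟ x) refl) ◅ ε

    s≢ : _≢_ {A = Label t} (hub s) (hub s′)
    s≢ refl = s≢s′ L refl

    linkage : Linkage own′ P′ s s′ x b
    linkage = record
      { s≢s′ = s≢s′ L
      ; path-label = λ {j} {v} v∈ → relabel-keeps (_≟ x) (λ v≡x _ → new v≡x v∈) (path-label L (P′⊆P v∈))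
      ; label-path = λ {j} {v} eq → let v≢x , eq′ = relabel⁻ (_≟ x) eq λ () in
          updated (λ j ys → v ∈ P j → v ∈ ys)
            (λ v∈ → tail v≢x (subst (v ∈_) Pi v∈)) (λ _ _ v∈ → v∈) j (label-path L eq′)
      ; unique = updated (λ _ → Unique) (unique-tail (subst Unique Pi (unique L i))) λ j _ → unique L j
      ; link = updated (λ _ ys → ys ≡ [] ⊎ Path (Own own′ (hub s)) ys (Own own′ (hub s′)))
          (proj₂ first) λ j _ → kept (link L j)
      ; a-hub = relabel-yes (_≟ x) refl
      ; b-hub = keep (λ ()) (b-hub L)
      ; a-linked = a-joined
      ; b-linked = λ eq → map (λ (e , p , q) → e , keep (λ ()) p , keep (λ ()) q)
          (b-linked L (proj₂ (relabel⁻ (_≟ x) eq s≢)))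
      ; cover = cover′
      }
      where
      new : ∀ {j v} → v ≡ x → v ∉ P′ j
      new {j} {v} refl = updated (λ _ → v ∉_) (λ v∈ → x∉ v∈ refl)
        (λ j j≢i v∈ → j≢i (path-injective (trans (sym (path-label L v∈)) x-path))) j
        where
        path-injective : ∀ {i j} → _≡_ {A = Label t} (path i) (path j) → i ≡ j
        path-injective refl = refl
      tail : ∀ {v} → v ≢ x → v ∈ x ∷ xs → v ∈ xs
      tail v≢x (here v≡x) = contradiction v≡x v≢x
      tail v≢x (there v∈) = v∈
      unique-tail : ∀ {x xs} → Unique (x ∷ xs) → Unique xs
      unique-tail (_ ∷ u) = u
      kept : ∀ {ys} → ys ≡ [] ⊎ Path (Own own (hub s)) ys (Own own (hub s′)) →
             ys ≡ [] ⊎ Path (Own own′ (hub s)) ys (Own own′ (hub s′))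
      kept (inj₁ eq) = inj₁ eq
      kept (inj₂ p) = inj₂ (path-mono (keep λ ()) (keep λ ()) _ p)
      cover′ : ∀ {u} → Frontier own′ u → u ≡ x ⊎ u ≡ b ⊎ ∃[ j ] u ∈ P′ j
      cover′ {u} (u≢ , v , vr , e) with u ≟ x
      ... | yes u≡x = inj₁ u≡x
      ... | no u≢x
            with frontier ← (u≢ ∘ keep (λ ()) , v , proj₂ (relabel⁻ (_≟ x) vr λ ()) , e)
            | cover L frontier
      ...   | inj₁ refl = contradiction frontier ¬a
      ...   | inj₂ (inj₁ u≡b) = inj₂ (inj₁ u≡b)
      ...   | inj₂ (inj₂ (j , u∈)) = inj₂ (inj₂ (j ,
        updated (λ j ys → u ∈ P j → u ∈ ys)
          (λ u∈ → tail u≢x (subst (u ∈_) Pi u∈)) (λ _ _ u∈ → u∈) j u∈))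

    shrinks : Shrinks own own′ P P′
    shrinks = record
      { robber⇒ = keep λ ()
      ; robber⇐ = λ eq → proj₂ (relabel⁻ (_≟ x) eq λ ())
      ; paths = P′⊆P
      }

  record Touching (own : Labelling) (P : Fin t → List (Fin n)) (s s′ : Bool) (b : Fin n) : Set where
    field
      {own′}   : Labelling
      {P′}     : Fin t → List (Fin n)
      {a}      : Fin n
      linkage  : Linkage own′ P′ s s′ a b
      shrinks  : Shrinks own own′ P P′
      touches  : Frontier own′ a

  -- If `a` does not touch the territory, `u` lies on a path. That path is eaten until the eaten
  -- vertex touches; this happens at `u` at the latest.
  touch : ∀ {own P s s′ a b} → Linkage own P s s′ a b → ∀ {u} → Frontier own u → u ≢ b →
          Touching own P s s′ b
  touch {own} {P} {s} {s′} {a} {b} L {u} fu u≢b with frontier? own a | cover L fu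
  ... | yes fa | _ = record
    { linkage = L
    ; shrinks = record { robber⇒ = λ r → r ; robber⇐ = λ r → r ; paths = λ p → p }
    ; touches = fa
    }
  ... | no ¬fa | inj₁ refl = contradiction fu ¬fa
  ... | no ¬fa | inj₂ (inj₁ u≡b) = contradiction u≡b u≢b
  ... | no ¬fa | inj₂ (inj₂ (i , u∈)) = eatAlong (P i) L refl u∈ fu ¬fa
    where
    eatAlong : ∀ xs {own P a} → Linkage own P s s′ a b → P i ≡ xs → u ∈ xs → Frontier own u →
               ¬ Frontier own a → Touching own P s s′ b
    eatAlong (x ∷ xs) {own} {P} L eq u∈ fu ¬fa with frontier? (Eat.own′ L ¬fa eq) x | u∈
    ... | yes fx | _ = record
      { linkage = Eat.linkage L ¬fa eq
      ; shrinks = Eat.shrinks L ¬fa eq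
      ; touches = fx
      }
    ... | no ¬fx | here refl = contradiction (frontier-resp (Eat.shrinks L ¬fa eq) fu) ¬fx
    ... | no ¬fx | there u∈xs = record
      { linkage = Touching.linkage rest
      ; shrinks = shrinks-trans (Eat.shrinks L ¬fa eq) (Touching.shrinks rest)
      ; touches = Touching.touches rest
      }
      where
      rest = eatAlong xs (Eat.linkage L ¬fa eq) (update-same P i) u∈xs
               (frontier-resp (Eat.shrinks L ¬fa eq) fu) ¬fx

-- Adding and dropping paths, confining the territory

module LinkageChanges {n : ℕ} (G : Graph n) (t : ℕ) where

  open Linkages G t public
  open Linkage

  path-injective : ∀ {i j} → _≡_ {A = Label t} (path i) (path j) → i ≡ j
  path-injective refl = refl

  -- No vertex enters or leaves a hub, so everything about the hubs carries over and only paths and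
  -- frontier remain to be checked.
  relabelLinkage : ∀ {own P P′ s s′ a b} → Linkage own P s s′ a b →
    ∀ {D : Fin n → Set} (D? : Decidable D) {ℓ} →
    (∀ {v s} → D v → own v ≢ hub s) → (∀ {s} → ℓ ≢ hub s) →
    let own′ = relabel D? ℓ own in
    (∀ {i v} → v ∈ P′ i → own′ v ≡ path i) →
    (∀ {i v} → own′ v ≡ path i → v ∈ P′ i) →
    (∀ i → Unique (P′ i)) →
    (∀ i → P′ i ≡ [] ⊎ Path (Own own (hub s)) (P′ i) (Own own (hub s′))) →
    (∀ {u} → Frontier own′ u → u ≡ a ⊎ u ≡ b ⊎ ∃[ i ] u ∈ P′ i) →
    Linkage own′ P′ s s′ a b
  relabelLinkage {own} {P′ = P′} {s} {s′} L D? {ℓ} avoids ℓ≢hub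
                 path-label′ label-path′ unique′ link′ cover′ = record
    { s≢s′ = s≢s′ L
    ; path-label = path-label′
    ; label-path = label-path′
    ; unique = unique′
    ; link = λ i → mono (link′ i)
    ; a-hub = keep (a-hub L)
    ; b-hub = keep (b-hub L)
    ; a-linked = λ eq → map (λ (e , p , q) → e , keep p , keep q) (a-linked L (old eq))
    ; b-linked = λ eq → map (λ (e , p , q) → e , keep p , keep q) (b-linked L (old eq))
    ; cover = cover′
    }
    where
    own′ = relabel D? ℓ own
    keep : ∀ {v s} → own v ≡ hub s → own′ v ≡ hub s
    keep = relabel-keeps D? avoids
    old : ∀ {v s} → own′ v ≡ hub s → own v ≡ hub s
    old eq = proj₂ (relabel⁻ D? eq ℓ≢hub)
    mono : ∀ {xs} → xs ≡ [] ⊎ Path (Own own (hub s)) xs (Own own (hub s′)) →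
           xs ≡ [] ⊎ Path (Own own′ (hub s)) xs (Own own′ (hub s′))
    mono (inj₁ empty) = inj₁ empty
    mono (inj₂ p)     = inj₂ (path-mono keep keep _ p)

  clash : ∀ {ℓ k k′ : Label t} → ℓ ≡ k → k ≢ k′ → ℓ ≢ k′
  clash refl k≢k′ = k≢k′

  module _ {own P s s′ a b} (L : Linkage own P s s′ a b) where

    addPath : ∀ {f xs} → P f ≡ [] → (∀ {v} → v ∈ xs → own v ≡ robber) → Unique xs →
              Path (Own own (hub s)) xs (Own own (hub s′)) →
              Linkage (relabel (_∈? xs) (path f) own) (updateAt P f (const xs)) s s′ a b
    addPath {f} {xs} Pf free uniq p = relabelLinkage L (_∈? xs)
      (λ v∈ → clash (free v∈) λ ()) (λ ())
      (λ {j} {v} → updated (λ j ys → v ∈ ys → own′ v ≡ path j) (relabel-yes (_∈? xs))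
        (λ j _ v∈ → relabel-keeps (_∈? xs) (λ v∈xs → clash (free v∈xs) λ ()) (path-label L v∈)) j)
      label-path′
      (updated (λ _ → Unique) uniq λ j _ → unique L j)
      (updated (λ _ ys → ys ≡ [] ⊎ Path (Own own (hub s)) ys (Own own (hub s′)))
        (inj₂ p) λ j _ → link L j)
      cover′
      where
      own′ = relabel (_∈? xs) (path f) own
      P′ = updateAt P f (const xs)
      kept : ∀ {j v} → v ∈ P j → v ∈ P′ j
      kept {j} {v} = updated (λ j ys → v ∈ P j → v ∈ ys)
        (λ v∈ → contradiction (subst (v ∈_) Pf v∈) λ ()) (λ _ _ v∈ → v∈) j
      label-path′ : ∀ {j v} → own′ v ≡ path j → v ∈ P′ j
      label-path′ {j} {v} eq with v ∈? xs
      ... | no v∉   = kept (label-path L (trans (sym (relabel-no (_∈? xs) v∉)) eq))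
      ... | yes v∈ with path-injective (trans (sym (relabel-yes (_∈? xs) v∈)) eq)
      ...   | refl = subst (v ∈_) (sym (update-same P f)) v∈
      cover′ : ∀ {u} → Frontier own′ u → u ≡ a ⊎ u ≡ b ⊎ ∃[ i ] u ∈ P′ i
      cover′ {u} (u≢ , v , vr , e) with u ∈? xs
      ... | yes u∈ = inj₂ (inj₂ (f , subst (u ∈_) (sym (update-same P f)) u∈))
      ... | no u∉ with cover L ((λ ur → u≢ (trans (relabel-no (_∈? xs) u∉) ur)) ,
                               v , proj₂ (relabel⁻ (_∈? xs) vr λ ()) , e)
      ...   | inj₁ u≡a = inj₁ u≡a
      ...   | inj₂ (inj₁ u≡b) = inj₂ (inj₁ u≡b)
      ...   | inj₂ (inj₂ (j , u∈)) = inj₂ (inj₂ (j , kept u∈))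

    -- The territory outside the component `C` becomes idle. By `closed` none of it is adjacent to
    -- `C`, so no frontier vertex is new.
    module Confine {C : Fin n → Set} (C? : Decidable C)
                   (inside : ∀ {v} → C v → own v ≡ robber)
                   (closed : ∀ {u v} → own u ≡ robber → C v → Adj G u v → C u) where

      outside? : Decidable (λ v → own v ≡ robber × ¬ C v)
      outside? v = robber? (own v) ×-dec ¬? (C? v)

      confined : Labelling
      confined = relabel outside? idle own

      confined-inside : ∀ {v} → C v → confined v ≡ robber
      confined-inside Cv = relabel-keeps outside? (λ (_ , ¬Cv) _ → ¬Cv Cv) (inside Cv)

      confined-robber : ∀ {v} → confined v ≡ robber → C v
      confined-robber {v} eq with ¬out , vr ← relabel⁻ outside? eq (λ ()) =
        decidable-stable (C? v) λ ¬Cv → ¬out (vr , ¬Cv)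

      frontier-confined : ∀ {u} → Frontier confined u → Frontier own u
      frontier-confined (u≢ , v , vr , e) =
        (λ ur → u≢ (confined-inside (closed ur Cv (adj-sym G e)))) , v , inside Cv , e
        where Cv = confined-robber vr

      confine : Linkage confined P s s′ a b
      confine = relabelLinkage L outside?
        (λ (vr , _) → clash vr λ ()) (λ ())
        (λ v∈ → relabel-keeps outside? (λ (vr , _) → clash vr λ ()) (path-label L v∈))
        (λ eq → label-path L (proj₂ (relabel⁻ outside? eq λ ())))
        (unique L) (link L) (cover L ∘ frontier-confined)

    dropPath : ∀ i → (∀ {u} → u ∈ P i → ¬ Frontier own u) →
               Linkage (relabel (_∈? P i) idle own) (updateAt P i (const [])) s s′ a b
    dropPath i untouched = relabelLinkage L (_∈? P i)
      (λ v∈ → clash (path-label L v∈) λ ()) (λ ())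
      (λ {j} {v} → updated (λ j ys → v ∈ ys → own′ v ≡ path j) (λ ())
        (λ j j≢i v∈ → relabel-keeps (_∈? P i)
          (λ v∈i eq → j≢i (path-injective (trans (sym eq) (path-label L v∈i)))) (path-label L v∈)) j)
      (λ {j} {v} eq → let v∉ , eq = relabel⁻ (_∈? P i) eq (λ ()) in
        updated (λ j ys → v ∈ P j → v ∈ ys)
          (λ v∈ → contradiction v∈ v∉) (λ _ _ v∈ → v∈) j (label-path L eq))
      (updated (λ _ → Unique) [] λ j _ → unique L j)
      (updated (λ _ ys → ys ≡ [] ⊎ Path (Own own (hub s)) ys (Own own (hub s′)))
        (inj₁ refl) λ j _ → link L j)
      cover′
      where
      own′ = relabel (_∈? P i) idle own
      P′ = updateAt P i (const [])
      cover′ : ∀ {u} → Frontier own′ u → u ≡ a ⊎ u ≡ b ⊎ ∃[ j ] u ∈ P′ j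
      cover′ {u} (u≢ , v , vr , e)
        with frontier ← ((λ ur → u≢ (relabel-keeps (_∈? P i) (λ u∈ → clash (path-label L u∈) λ ()) ur)) ,
                         v , proj₂ (relabel⁻ (_∈? P i) vr λ ()) , e)
        with cover L frontier
      ... | inj₁ u≡a = inj₁ u≡a
      ... | inj₂ (inj₁ u≡b) = inj₂ (inj₁ u≡b)
      ... | inj₂ (inj₂ (j , u∈)) = inj₂ (inj₂ (j ,
        updated (λ j ys → u ∈ P j → u ∈ ys)
          (λ u∈ → contradiction frontier (untouched u∈)) (λ _ _ u∈ → u∈) j u∈))

  -- The minor given by a linkage with every path touched

  -- Territory and hubs form the part of size three, the paths the part of size `t`.
  branch : Label t → Maybe (Fin (3 + t))
  branch robber      = just zero
  branch (hub true)  = just (suc zero)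
  branch (hub false) = just (suc (suc zero))
  branch (path i)    = just (suc (suc (suc i)))
  branch idle        = nothing

  label : Fin (3 + t) → Label t
  label zero                = robber
  label (suc zero)          = hub true
  label (suc (suc zero))    = hub false
  label (suc (suc (suc i))) = path i

  branch-label : ∀ x → branch (label x) ≡ just x
  branch-label zero                = refl
  branch-label (suc zero)          = refl
  branch-label (suc (suc zero))    = refl
  branch-label (suc (suc (suc i))) = refl

  label-branch : ∀ ℓ {x} → branch ℓ ≡ just x → ℓ ≡ label x
  label-branch robber      refl = refl
  label-branch (hub true)  refl = refl
  label-branch (hub false) refl = refl
  label-branch (path i)    refl = refl

  module _ {own P s s′ a b r} (L : Linkage own P s s′ a b)
           (r-robber : own r ≡ robber)
           (r-linked : ∀ {v} → own v ≡ robber → Star (Within (Own own robber)) v r)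
           (touched : ∀ i → Any (Frontier own) (P i)) where

    Rooted : Label t → Set
    Rooted ℓ = ∃[ x ] (own x ≡ ℓ × (∀ {v} → own v ≡ ℓ → Star (Within (Own own ℓ)) v x))

    side : ∀ s″ → s″ ≡ s ⊎ s″ ≡ s′
    side s″ = go s s′ s″ (s≢s′ L)
      where
      go : ∀ s s′ s″ → s ≢ s′ → s″ ≡ s ⊎ s″ ≡ s′
      go true  _     true  _ = inj₁ refl
      go false _     false _ = inj₁ refl
      go true  false false _ = inj₂ refl
      go false true  true  _ = inj₂ refl
      go true  true  false s≢s′ = contradiction refl s≢s′
      go false false true s≢s′ = contradiction refl s≢s′

    -- A touched list is not empty, which leaves only the second alternative of `link`.
    fullPath : ∀ i → ∃[ x ] ∃[ xs ] (P i ≡ x ∷ xs × Path (Own own (hub s)) (x ∷ xs) (Own own (hub s′)))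
    fullPath i with P i | touched i | link L i
    ... | x ∷ xs | _ | inj₂ p = x , xs , refl , p

    rooted-hub : ∀ s″ → Rooted (hub s″)
    rooted-hub s″ with side s″
    ... | inj₁ refl = a , a-hub L , a-linked L
    ... | inj₂ refl = b , b-hub L , b-linked L

    rooted-path : ∀ i → Rooted (path i)
    rooted-path i with x , xs , Pi , p ← fullPath i =
      x , path-label L (subst (x ∈_) (sym Pi) (here refl)) , λ eq →
      map (λ (e , u∈ , v∈) → e , labelled u∈ , labelled v∈)
        (path-linked x xs p (subst (_ ∈_) Pi (label-path L eq)))
      where
      labelled : ∀ {v} → v ∈ _ → own v ≡ path i
      labelled v∈ = path-label L (subst (_ ∈_) (sym Pi) v∈)

    rooted : ∀ x → Rooted (label x)
    rooted zero                = r , r-robber , r-linked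
    rooted (suc zero)          = rooted-hub true
    rooted (suc (suc zero))    = rooted-hub false
    rooted (suc (suc (suc i))) = rooted-path i

    Joined : Label t → Label t → Set
    Joined ℓ k = ∃[ u ] ∃[ v ] (own u ≡ ℓ × own v ≡ k × Adj G u v)

    joined-sym : ∀ {ℓ k} → Joined ℓ k → Joined k ℓ
    joined-sym (u , v , p , q , e) = v , u , q , p , adj-sym G e

    robber-path : ∀ i → Joined robber (path i)
    robber-path i with u , u∈ , _ , v , vr , e ← find (touched i) = v , u , vr , path-label L u∈ , e

    hub-path : ∀ s″ i → Joined (hub s″) (path i)
    hub-path s″ i with side s″ | fullPath i
    ... | inj₁ refl | x , xs , Pi , (w , hw , e) , _ =
      w , x , hw , path-label L (subst (x ∈_) (sym Pi) (here refl)) , e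
    ... | inj₂ refl | x , xs , Pi , p with u , v , u∈ , hv , e ← path-last x xs p =
      v , u , hv , path-label L (subst (u ∈_) (sym Pi) u∈) , adj-sym G e

    joined : ∀ x y → Adj (K 3 t) x y → Joined (label x) (label y)
    joined zero             (suc (suc (suc i))) _ = robber-path i
    joined (suc zero)       (suc (suc (suc i))) _ = hub-path true i
    joined (suc (suc zero)) (suc (suc (suc i))) _ = hub-path false i
    joined (suc (suc (suc i))) zero             _ = joined-sym (robber-path i)
    joined (suc (suc (suc i))) (suc zero)       _ = joined-sym (hub-path true i)
    joined (suc (suc (suc i))) (suc (suc zero)) _ = joined-sym (hub-path false i)

    K₃-minor : K 3 t ≼ G
    K₃-minor = model⇒≼ record
      { μ = branch ∘ own
      ; root = proj₁ ∘ rooted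
      ; μ-root = λ x → as x (proj₁ (proj₂ (rooted x)))
      ; connected = λ {x} {v} eq →
          map (λ (e , p , q) → e , as x p , as x q) (proj₂ (proj₂ (rooted x)) (label-branch (own v) eq))
      ; edge = λ {x} {y} e → let u , v , p , q , uv = joined x y e in u , v , as x p , as y q , uv
      }
      where
      as : ∀ x {v} → own v ≡ label x → branch (own v) ≡ just x
      as x eq = trans (cong branch eq) (branch-label x)

-- The pursuit

removeElement : ∀ {n k} {y : Fin n} xs → y ∈ xs → length xs ≤ suc k →
                ∃[ ys ] (length ys ≤ k × (∀ {v} → v ∈ xs → v ≢ y → v ∈ ys))
removeElement {y = y} xs y∈ len =
  filter ≢y? xs , ≤-pred (≤-trans (filter-notAll ≢y? xs (lose y∈ (λ ≢y → ≢y refl))) len) , ∈-filter⁺ ≢y?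
  where ≢y? = λ v → ¬? (v ≟ y)

module Pursuit {n : ℕ} (G : Graph n) (connected : Connected G) (t : ℕ) where

  open Game G
  open LinkageChanges G t
  open Linkage

  Cops = Fin t → Fin n

  crossing : ∀ {T : Fin n → Set} → Decidable T → ∀ {a r} → ¬ T a → T r →
             ∃[ u ] ∃[ v ] (¬ T u × T v × Adj G v u)
  crossing {T} T? {a} {r} ¬Ta Tr = along ¬Ta (connected a r)
    where
    along : ∀ {u} → ¬ T u → Star (Adj G) u r → ∃[ u ] ∃[ v ] (¬ T u × T v × Adj G v u)
    along ¬Tr ε = contradiction Tr ¬Tr
    along ¬Tu (_◅_ {j = v} e es) with T? v
    ... | yes Tv = _ , v , ¬Tu , Tv , adj-sym G e
    ... | no ¬Tv = along ¬Tv es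

  Moves : (Fin n → Set) → (Fin n → Fin n) → Set
  Moves T h = ∀ {u v} → T u → T v → Adj G u v → Step G (h u) (h v)

  Guards : (Fin n → Set) → (Fin n → Fin n) → Fin n → Set
  Guards T h x = ∀ {u} → T u → Adj G u x → Step G (h u) x

  -- On the cops' turn, every cop i ≢ f is within one step of its target g i r.
  module Hold {T : Fin n → Set} (T? : Decidable T) (g : Fin t → Fin n → Fin n) (f : Fin t)
              (moves : ∀ {i} → i ≢ f → Moves T (g i))
              (guarded : ∀ {x v} → ¬ T x → T v → Adj G v x → ∃[ i ] (i ≢ f × Guards T (g i) x)) where

    Near : Cops → Fin n → Set
    Near c r = ∀ i → i ≢ f → Step G (c i) (g i r)

    -- The other cops move onto their targets for `r` while `f` steps to `y`. A robber who then
    -- leaves `T` enters the reach of a guard; otherwise the targets move by one step at most and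
    -- `Near` is restored.
    hold : ∀ {c r} → T r → Near c r → ∀ {y} → Step G (c f) y →
           (∀ {c′ r′} → T r′ → Near c′ r′ → c′ f ≡ y → Step G r r′ → Win c′ r′) → Win c r
    hold {c} {r} Tr near {y} cf→y continue = advance c′
      (updated (λ i z → Step G (c i) z) cf→y near) λ r′ s → reply s
      where
      c′ = updateAt (λ i → g i r) f (const y)
      near′ : ∀ {r′} → (∀ i → i ≢ f → Step G (g i r) (g i r′)) → Near c′ r′
      near′ {r′} = updated (λ i z → i ≢ f → Step G z (g i r′)) (contradiction refl) ∘
                   λ st i i≢f _ → st i i≢f
      reply : ∀ {r′} → Step G r r′ → Win c′ r′
      reply (inj₁ refl) = continue Tr (near′ λ _ _ → inj₁ refl) (update-same _ f) (inj₁ refl)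
      reply {r′} (inj₂ e) with T? r′
      ... | yes Tr′ = continue Tr′ (near′ λ i i≢f → moves i≢f Tr Tr′ e) (update-same _ f) (inj₂ e)
      ... | no ¬Tr′ with i , i≢f , guards ← guarded ¬Tr′ Tr e =
        grab i (subst (λ z → Step G z r′) (sym (update-other _ i≢f)) (guards Tr e))

    module _ {X : Fin n → Set} (sweep : Sweep T X) where

      open Sweep sweep

      g⁺ : Fin t → Fin n → Fin n
      g⁺ = updateAt g f (const shadow)

      moves⁺ : ∀ i → Moves T (g⁺ i)
      moves⁺ i {u} {v} Tu Tv e = updated (λ _ (h : Fin n → Fin n) → Step G (h u) (h v))
        (line-near line-step (lipschitz Tv Tu (adj-sym G e)) (lipschitz Tu Tv e))
        (λ i i≢f → moves i≢f Tu Tv e) i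

      module _ (continue : ∀ {c r} → T r → (∀ i → Step G (c i) (g⁺ i r)) → Win c r) where

        engage : ∀ {c r} → T r → Near c r → Step G (c f) (shadow r) → Win c r
        engage {c} {r} Tr near cf =
          continue Tr (updated (λ i (h : Fin n → Fin n) → Step G (c i) (h r)) cf near)

        -- A cop behind the shadow gains on it or is met by it, as the shadow makes
        -- single steps.
        climb : ∀ fuel j → len ≤ j + fuel → ∀ {c r} → T r → Near c r → c f ≡ line j →
                j ≤ suc (pos r) → Win c r
        climb fuel j enough {c} {r} Tr near cf j≤ with pos r ≤? suc j
        ... | yes close = engage Tr near
          (subst (λ z → Step G z (shadow r)) (sym cf) (step-sym (line-near line-step close j≤)))
        climb zero j enough {c} {r} Tr near cf j≤ | no far = contradiction
          (≤-trans (pos≤len r) (≤-trans enough (≤-trans (≤-reflexive (+-identityʳ j)) (n≤1+n j)))) far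
        climb (suc fuel) j enough {c} {r} Tr near cf j≤ | no far =
          hold Tr near (subst (λ z → Step G z (line (suc j))) (sym cf) (line-step j))
            λ Tr′ near′ cf′ s → climb fuel (suc j) (subst (len ≤_) (+-suc j fuel) enough) Tr′ near′ cf′
              (≤-trans (≤-pred (≤-trans (≰⇒> far) (back s Tr′))) (n≤1+n _))
          where
          back : ∀ {r′} → Step G r r′ → T r′ → pos r ≤ suc (pos r′)
          back (inj₁ refl) _ = n≤1+n _
          back (inj₂ e) Tr′  = lipschitz Tr′ Tr (adj-sym G e)

        -- At the start of the line the cop is not ahead of any shadow, so `climb` applies from
        -- `j = 0` wherever the robber is.
        approach : ∀ {z} → Star (Adj G) z (line 0) → ∀ {c r} → T r → Near c r → c f ≡ z → Win c r
        approach ε Tr near cf = climb len 0 ≤-refl Tr near cf z≤n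
        approach (e ◅ es) Tr near cf =
          hold Tr near (subst (λ z → Step G z _) (sym cf) (inj₂ e))
            λ Tr′ near′ cf′ _ → approach es Tr′ near′ cf′

        intercept : ∀ {c r} → T r → Near c r → Win c r
        intercept {c} Tr near = approach (connected (c f) (line 0)) Tr near refl

  -- Cop `q` guards both `a` and `b`, besides its path if it has one. The whereabouts of `f` are
  -- arbitrary. The list `territory` makes the induction measure a length.
  record Position (k : ℕ) (c : Cops) (r : Fin n) : Set where
    field
      {own}      : Labelling
      {P}        : Fin t → List (Fin n)
      {s s′}     : Bool
      {a b}      : Fin n
      linkage    : Linkage own P s s′ a b
      r-robber   : own r ≡ robber
      r-linked   : ∀ {v} → own v ≡ robber → Star (Within (Own own robber)) v r
      g          : Fin t → Fin n → Fin n
      q f        : Fin t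
      q≢f        : q ≢ f
      f-free     : P f ≡ []
      moves      : ∀ {i} → i ≢ f → Moves (Own own robber) (g i)
      path-guard : ∀ {i x} → x ∈ P i → Guards (Own own robber) (g i) x
      a-guard    : Guards (Own own robber) (g q) a
      b-guard    : Guards (Own own robber) (g q) b
      near       : ∀ i → i ≢ f → Step G (c i) (g i r)
      territory  : List (Fin n)
      territory⁺ : ∀ {v} → own v ≡ robber → v ∈ territory
      size≤k     : length territory ≤ k

  Winning : ℕ → Set
  Winning k = ∀ {c r} → Position k c r → Win c r

  -- If x is the only vertex next to T, a cop on a neighbour y of x in T guards both.
  module Restart {k} (win : Winning k) {T : Fin n → Set} (T? : Decidable T)
                 (g : Fin t → Fin n → Fin n) {q f : Fin t} (q≢f : q ≢ f)
                 (moves : ∀ {i} → i ≢ f → Moves T (g i))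
                 (guarded : ∀ {x v} → ¬ T x → T v → Adj G v x → ∃[ i ] (i ≢ f × Guards T (g i) x))
                 {x : Fin n} (only : ∀ {u v} → ¬ T u → T v → Adj G v u → u ≡ x)
                 {z : Fin n} (¬Tz : ¬ T z)
                 (territory : List (Fin n)) (territory⁺ : ∀ {v} → T v → v ∈ territory)
                 (size≤ : length territory ≤ suc k) where

    open Hold T? g f moves guarded

    restart : ∀ {c r} → T r → Near c r → Win c r
    restart {r = r} Tr near₀ with crossing T? ¬Tz Tr
    ... | x′ , y , ¬Tx , Ty , yx with refl ← only ¬Tx Ty yx = intercept sweep continue Tr near₀
      where
      sweep : Sweep T (λ v → v ≡ x ⊎ v ≡ y)
      sweep = record
        -- The line is the single vertex `y`: a cop there answers an entry into `y` by staying and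
        -- one into `x` along the edge.
        { line = const y ; line-step = λ _ → inj₁ refl ; pos = const 0 ; len = 0
        ; pos≤len = λ _ → z≤n ; lipschitz = λ _ _ _ → z≤n
        ; blocks = λ { _ (inj₁ refl) _ → inj₂ yx ; _ (inj₂ refl) _ → inj₁ refl }
        ; hits = λ { Tx (inj₁ refl) → contradiction Tx ¬Tx ; _ (inj₂ refl) → refl }
        }

      h = g⁺ sweep

      T′ : Fin n → Set
      T′ v = T v × v ≢ y

      T′? : Decidable T′
      T′? v = T? v ×-dec ¬? (v ≟ y)

      module _ {c : Cops} {r : Fin n} (T′r : T′ r) (near : ∀ i → Step G (c i) (h i r)) where

        open Component (component T′? r T′r) renaming (base to C-base)

        inner mid own : Labelling
        inner = relabel C? robber (const idle)
        mid   = relabel (_≟ y) (hub false) inner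
        own   = relabel (_≟ x) (hub true) mid

        robber⁺ : ∀ {v} → C v → own v ≡ robber
        robber⁺ {v} Cv = trans (relabel-no (_≟ x) λ { refl → ¬Tx (proj₁ (inside Cv)) })
          (trans (relabel-no (_≟ y) (proj₂ (inside Cv))) (relabel-yes C? Cv))

        own⁻ : ∀ {v ℓ} → own v ≡ ℓ → hub true ≢ ℓ → hub false ≢ ℓ → idle ≢ ℓ → C v × robber ≡ ℓ
        own⁻ {v} eq t≢ f≢ i≢ with C? v
        ... | yes Cv = Cv , trans (sym (relabel-yes C? Cv))
          (proj₂ (relabel⁻ (_≟ y) (proj₂ (relabel⁻ (_≟ x) eq t≢)) f≢))
        ... | no ¬Cv = contradiction (trans (sym (relabel-no C? ¬Cv))
          (proj₂ (relabel⁻ (_≟ y) (proj₂ (relabel⁻ (_≟ x) eq t≢)) f≢))) i≢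

        inner-hub : ∀ {v s} → inner v ≢ hub s
        inner-hub {v} eq with C? v
        ... | yes Cv with () ← trans (sym (relabel-yes C? Cv)) eq
        ... | no ¬Cv with () ← trans (sym (relabel-no C? ¬Cv)) eq

        robber⁻ : ∀ {v} → own v ≡ robber → C v
        robber⁻ eq = proj₁ (own⁻ eq (λ ()) (λ ()) λ ())

        hub-true : ∀ {v} → own v ≡ hub true → v ≡ x
        hub-true {v} eq with v ≟ x
        ... | yes v≡x = v≡x
        ... | no v≢x = contradiction
          (proj₂ (relabel⁻ (_≟ y) (trans (sym (relabel-no (_≟ x) v≢x)) eq) λ ())) inner-hub

        hub-false : ∀ {v} → own v ≡ hub false → v ≡ y
        hub-false {v} eq with v ≟ y
        ... | yes v≡y = v≡y
        ... | no v≢y = contradiction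
          (trans (sym (relabel-no (_≟ y) v≢y)) (proj₂ (relabel⁻ (_≟ x) eq λ ()))) inner-hub

        edgeLinkage : Linkage own (const []) true false x y
        edgeLinkage = record
          { s≢s′ = λ ()
          ; path-label = λ ()
          ; label-path = λ eq → contradiction (proj₂ (own⁻ eq (λ ()) (λ ()) λ ())) λ ()
          ; unique = λ _ → []
          ; link = λ _ → inj₁ refl
          ; a-hub = relabel-yes (_≟ x) refl
          ; b-hub = trans (relabel-no (_≟ x) λ { refl → ¬Tx Ty }) (relabel-yes (_≟ y) refl)
          ; a-linked = λ eq → subst (λ v → Star _ v x) (sym (hub-true eq)) ε
          ; b-linked = λ eq → subst (λ v → Star _ v y) (sym (hub-false eq)) ε
          ; cover = cover′
          }
          where
          cover′ : ∀ {u} → Frontier own u → u ≡ x ⊎ u ≡ y ⊎ ∃[ i ] u ∈ []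
          cover′ {u} (u≢ , v , vr , vu) with T? u | u ≟ y
          ... | no ¬Tu | _ = inj₁ (only ¬Tu (proj₁ (inside (robber⁻ vr))) vu)
          ... | yes _ | yes u≡y = inj₂ (inj₁ u≡y)
          ... | yes Tu | no u≢y =
            contradiction (robber⁺ (closed (Tu , u≢y) (robber⁻ vr) (adj-sym G vu))) u≢

        T⁻ : ∀ {v} → own v ≡ robber → T v
        T⁻ = proj₁ ∘ inside ∘ robber⁻

        y-guard : ∀ {w} → w ≡ x ⊎ w ≡ y → Guards (Own own robber) (h f) w
        y-guard w∈ ur uw = subst (λ k → Step G (k _) _) (sym (update-same g f))
          (Sweep.blocks sweep (T⁻ ur) w∈ uw)

        newPosition : Position k c r
        newPosition = record
          { linkage = edgeLinkage
          ; r-robber = robber⁺ C-base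
          ; r-linked = λ vr → map (λ (e , p , q) → e , robber⁺ p , robber⁺ q) (linked (robber⁻ vr))
          -- Cop `f` guards both ends of the edge and all paths are empty, so the former guard `q`
          -- can become the free cop.
          ; g = h ; q = f ; f = q ; q≢f = q≢f ∘ sym
          ; f-free = refl
          ; moves = λ {i} _ ur vr → moves⁺ sweep i (T⁻ ur) (T⁻ vr)
          ; path-guard = λ ()
          ; a-guard = y-guard (inj₁ refl)
          ; b-guard = y-guard (inj₂ refl)
          ; near = λ i _ → near i
          ; territory = proj₁ smaller
          ; territory⁺ = λ vr → proj₂ (proj₂ smaller) (territory⁺ (T⁻ vr)) (proj₂ (inside (robber⁻ vr)))
          ; size≤k = proj₁ (proj₂ smaller)
          }
          where smaller = removeElement territory (territory⁺ Ty) size≤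

      continue : ∀ {c r} → T r → (∀ i → Step G (c i) (h i r)) → Win c r
      continue {r = r} Tr near with r ≟ y
      ... | yes refl = grab f (subst (λ k → Step G _ (k y)) (update-same g f) (near f))
      ... | no r≢y   = win (newPosition (Tr , r≢y) near)

  module FromPosition {k c r} (p : Position k c r) where

    open Position p

    T : Fin n → Set
    T = Own own robber

    T? : Decidable T
    T? = robber? ∘ own

    guarded : ∀ {x v} → ¬ T x → T v → Adj G v x → ∃[ i ] (i ≢ f × Guards T (g i) x)
    guarded {x} ¬Tx Tv e with cover linkage (¬Tx , _ , Tv , e)
    ... | inj₁ refl = q , q≢f , a-guard
    ... | inj₂ (inj₁ refl) = q , q≢f , b-guard
    ... | inj₂ (inj₂ (i , x∈)) =
      i , (λ { refl → contradiction (subst (x ∈_) f-free x∈) λ () }) , path-guard x∈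

    a-outside : ¬ T a
    a-outside = clash (a-hub linkage) λ ()

  module Advance {k} (win : Winning k) (free : MinorFree (K 3 t) G) {c₀ r₀}
                 (p : Position (suc k) c₀ r₀) where

    open Position p
    open FromPosition p

    -- The guards remain those of the position `p` until `f` is in place; the modified linkage `L₁`
    -- only determines the ends of the new path.
    module _ {own₁ P₁ s₁ s₁′ a₁ b₁} (L₁ : Linkage own₁ P₁ s₁ s₁′ a₁ b₁)
             (S : Shrinks own own₁ P P₁)
             (a-frontier : Frontier own₁ a₁) (b-frontier : Frontier own₁ b₁) where

      open Shrinks S

      opaque

        geo : Geodesic T a₁ b₁
        geo = let a≢ , _ , ra′ , ea = a-frontier
                  b≢ , _ , rb′ , eb = b-frontier
              in geodesic T? r-linked (a≢ ∘ robber⇒) (b≢ ∘ robber⇒)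
                   (robber⇐ ra′) (adj-sym G ea) (robber⇐ rb′) eb

      open Geodesic geo

      open Hold T? g f moves guarded

      h : Fin t → Fin n → Fin n
      h = g⁺ sweep

      own₂ : Labelling
      own₂ = relabel (_∈? interior) (path f) own₁

      P₂ : Fin t → List (Fin n)
      P₂ = updateAt P₁ f (const interior)

      L₂ : Linkage own₂ P₂ s₁ s₁′ a₁ b₁
      L₂ = addPath L₁ P₁f≡[] (robber⇒ ∘ inside) distinct
             (path-mono (λ { refl → a-hub L₁ }) (λ { refl → b-hub L₁ }) interior route)
        where
        P₁f≡[] : P₁ f ≡ []
        P₁f≡[] with P₁ f in eq
        ... | []    = refl
        ... | x ∷ _ with () ← subst (x ∈_) f-free (paths (subst (x ∈_) (sym eq) (here refl)))

      module _ {c : Cops} {r : Fin n} (Tr : T r) (r∉ : r ∉ interior)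
               (near′ : ∀ i → Step G (c i) (h i r)) where

        own₂⁻ : ∀ {v} → own₂ v ≡ robber → v ∉ interior × T v
        own₂⁻ eq with v∉ , eq₁ ← relabel⁻ (_∈? interior) eq (λ ()) = v∉ , robber⇐ eq₁

        own₂⁺ : ∀ {v} → v ∉ interior → T v → own₂ v ≡ robber
        own₂⁺ v∉ Tv = trans (relabel-no (_∈? interior) v∉) (robber⇒ Tv)

        open Component (component (robber? ∘ own₂) r (own₂⁺ r∉ Tr))
          renaming (base to C-base; inside to C-inside)

        C⇒T : ∀ {v} → C v → T v
        C⇒T = proj₂ ∘ own₂⁻ ∘ C-inside

        smaller : ∃[ ys ] (length ys ≤ k × (∀ {v} → v ∈ territory → v ≢ _ → v ∈ ys))
        smaller = removeElement territory (territory⁺ (inside (proj₂ first))) size≤k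

        -- The vertex removed from the list is an interior vertex of the new path: it was in the
        -- territory and is not in the component.
        C⇒smaller : ∀ {v} → C v → v ∈ proj₁ smaller
        C⇒smaller Cv = proj₂ (proj₂ smaller) (territory⁺ (C⇒T Cv))
          λ { refl → proj₁ (own₂⁻ (C-inside Cv)) (proj₂ first) }

        open Confine L₂ C? C-inside closed using () renaming
          (confined to own₃; confine to L₃; confined-inside to own₃⁺; confined-robber to own₃⁻)

        touched? : ∀ i → Dec (Any (Frontier own₃) (P₂ i))
        touched? i = Any.any? (frontier? own₃) (P₂ i)

        relinked : ∀ {own′ : Labelling} → (∀ {v} → C v → own′ v ≡ robber) →
                   ∀ {v} → C v → Star (Within (Own own′ robber)) v r
        relinked C⇒ Cv = map (λ (e , p , q) → e , C⇒ p , C⇒ q) (linked Cv)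

        -- The old linkage is confined to `C`. This needs `C` to be closed in all of `T`, and it is,
        -- because no interior vertex of the new path is next to `C`.
        retreat : ¬ Any (Frontier own₃) (P₂ f) → Position k c r
        retreat untouched = record
          { linkage = L₀
          ; r-robber = own₀⁺ C-base
          ; r-linked = relinked own₀⁺ ∘ own₀⁻
          ; g = g ; q = q ; f = f ; q≢f = q≢f ; f-free = f-free
          ; moves = λ i≢f ur vr → moves i≢f (C⇒T (own₀⁻ ur)) (C⇒T (own₀⁻ vr))
          ; path-guard = λ x∈ ur → path-guard x∈ (C⇒T (own₀⁻ ur))
          ; a-guard = λ ur → a-guard (C⇒T (own₀⁻ ur))
          ; b-guard = λ ur → b-guard (C⇒T (own₀⁻ ur))
          ; near = λ i i≢f → subst (λ z → Step G (c i) (z r)) (update-other g i≢f) (near′ i)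
          ; territory = proj₁ smaller
          ; territory⁺ = C⇒smaller ∘ own₀⁻
          ; size≤k = proj₁ (proj₂ smaller)
          }
          where
          closed₀ : ∀ {u v} → T u → C v → Adj G u v → C u
          closed₀ {u} Tu Cv e with u ∈? interior
          ... | no u∉  = closed (own₂⁺ u∉ Tu) Cv e
          ... | yes u∈ = contradiction
            (lose (subst (u ∈_) (sym (update-same P₁ f)) u∈)
              ((λ ur → proj₁ (own₂⁻ (C-inside (own₃⁻ ur))) u∈) , _ , own₃⁺ Cv , adj-sym G e))
            untouched
          open Confine linkage C? C⇒T closed₀ using () renaming
            (confine to L₀; confined-inside to own₀⁺; confined-robber to own₀⁻)

        -- Cop `i` may be the old `q`: the hub vertices are now the ends of the new path, which `f`
        -- guards.
        extend-to : ∀ i → i ≢ f → ¬ Any (Frontier own₃) (P₂ i) → Position k c r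
        extend-to i i≢f untouched = record
          { linkage = dropPath L₃ i (λ u∈ fu → untouched (lose u∈ fu))
          ; r-robber = own₄⁺ C-base
          ; r-linked = relinked own₄⁺ ∘ own₄⁻
          ; g = h ; q = f ; f = i ; q≢f = i≢f ∘ sym ; f-free = update-same P₂ i
          ; moves = λ {j} _ ur vr → moves⁺ sweep j (T⁻ ur) (T⁻ vr)
          ; path-guard = guard
          ; a-guard = sweep-guard (inj₁ refl)
          ; b-guard = sweep-guard (inj₂ (inj₁ refl))
          ; near = λ j _ → near′ j
          ; territory = proj₁ smaller
          ; territory⁺ = C⇒smaller ∘ own₄⁻
          ; size≤k = proj₁ (proj₂ smaller)
          }
          where
          own₄ = relabel (_∈? P₂ i) idle own₃
          own₄⁺ : ∀ {v} → C v → own₄ v ≡ robber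
          own₄⁺ Cv = relabel-keeps (_∈? P₂ i) (λ v∈ → clash (path-label L₃ v∈) λ ()) (own₃⁺ Cv)
          own₄⁻ : ∀ {v} → own₄ v ≡ robber → C v
          own₄⁻ eq = own₃⁻ (proj₂ (relabel⁻ (_∈? P₂ i) eq λ ()))
          T⁻ : ∀ {v} → own₄ v ≡ robber → T v
          T⁻ = C⇒T ∘ own₄⁻
          sweep-guard : ∀ {x} → x ≡ a₁ ⊎ x ≡ b₁ ⊎ x ∈ interior → Guards (Own own₄ robber) (h f) x
          sweep-guard x∈ ur ux = subst (λ z → Step G (z _) _) (sym (update-same g f))
            (Sweep.blocks sweep (T⁻ ur) x∈ ux)
          guard : ∀ {j x} → x ∈ updateAt P₂ i (const []) j → Guards (Own own₄ robber) (h j) x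
          guard {j} {x} x∈ ur ux with updated⁻ (λ _ → x ∈_) j x∈
          ... | inj₂ (_ , x∈₂) with updated⁻ (λ _ → x ∈_) j x∈₂
          ...   | inj₁ (refl , x∈₁) = sweep-guard (inj₂ (inj₂ x∈₁)) ur ux
          -- A surviving path is part of an old one, so its old guard still serves.
          ...   | inj₂ (j≢f , x∈₁) = subst (λ z → Step G (z _) x) (sym (update-other g j≢f))
                                       (path-guard (paths x∈₁) (T⁻ ur) ux)

        next : Win c r
        next with any? (λ i → ¬? (touched? i))
        ... | no all = contradiction
          (K₃-minor L₃ (own₃⁺ C-base) (relinked own₃⁺ ∘ own₃⁻)
            λ i → decidable-stable (touched? i) λ ¬touched → all (i , ¬touched)) free
        ... | yes (i , untouched) with i ≟ f
        ...   | yes refl = win (retreat untouched)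
        ...   | no i≢f   = win (extend-to i i≢f untouched)

      advanceAlong : Win c₀ r₀
      advanceAlong = intercept sweep continue r-robber near
        where
        continue : ∀ {c r} → T r → (∀ i → Step G (c i) (h i r)) → Win c r
        continue {c} {r} Tr near′ with r ∈? interior
        ... | no r∉  = next Tr r∉ near′
        ... | yes r∈ = grab f (subst (Step G (c f))
          (trans (cong (λ z → z r) (update-same g f)) (Sweep.hits sweep Tr (inj₂ (inj₂ r∈)))) (near′ f))

  module Proceed {k} (win : Winning k) (free : MinorFree (K 3 t) G) {c r}
                 (p : Position (suc k) c r) where

    open Position p
    open FromPosition p

    single : ∀ {x} → (∀ {u} → Frontier own u → u ≡ x) → Win c r
    single only = Restart.restart win T? g q≢f moves guarded (λ ¬Tu Tv e → only (¬Tu , _ , Tv , e))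
                    a-outside territory territory⁺ size≤k r-robber near

    -- Each end of the new path needs its own frontier vertex; if there is at most one in all,
    -- `single` restarts. The second `touch` keeps the territory, hence `a′` still touches it.
    proceed : Win c r
    proceed with any? (λ u → frontier? own u ×-dec ¬? (u ≟ b))
    ... | no none = single λ {u} fu → decidable-stable (u ≟ b) λ u≢b → none (u , fu , u≢b)
    ... | yes (u , fu , u≢b) with touch linkage fu u≢b
    ...   | record { a = a′ ; linkage = L ; shrinks = S ; touches = fa′ }
          with any? (λ v → frontier? own v ×-dec ¬? (v ≟ a′))
    ...     | no none = single λ {v} fv → decidable-stable (v ≟ a′) λ v≢a′ → none (v , fv , v≢a′)
    ...     | yes (v , fv , v≢a′) with touch (flip L) (frontier-resp S fv) v≢a′
    ...       | record { linkage = L′ ; shrinks = S′ ; touches = fb′ } =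
      Advance.advanceAlong win free p L′ (shrinks-trans S S″) fb′ (frontier-resp S′ fa′)
      where
      S″ = record { robber⇒ = Shrinks.robber⇒ S′ ; robber⇐ = Shrinks.robber⇐ S′
                  ; paths = λ v∈ → reverse⁻ (Shrinks.paths S′ v∈) }

  module _ (free : MinorFree (K 3 t) G) where

    winning : ∀ k → Winning k
    winning zero p
      with Position.territory p | Position.territory⁺ p (Position.r-robber p) | Position.size≤k p
    -- The robber's own vertex is in the list, so its length is not zero.
    ... | _ ∷ _ | _ | ()
    winning (suc k) p = Proceed.proceed (winning k) free p

    -- With all cops on `z` and everything else as territory, `z` is the only vertex next to the
    -- territory: the opening is itself a restart.
    copsWin : ∀ {q f : Fin t} → q ≢ f → Fin n → CopsWin G t
    copsWin {q} {f} q≢f z = win⇒copsWin (const z) start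
      where
      start : ∀ r → Win (const z) r
      start r with z ≟ r
      ... | yes refl = grab q (inj₁ refl)
      ... | no z≢r = Restart.restart (winning n) {T = z ≢_} (λ v → ¬? (z ≟ v)) (λ _ _ → z) {q} {f} q≢f
        (λ _ _ _ _ → inj₁ refl)
        (λ {x} ¬z≢x _ _ → q , q≢f , λ _ _ → inj₁ (decidable-stable (z ≟ x) ¬z≢x))
        (λ {u} ¬z≢u _ _ → sym (decidable-stable (z ≟ u) ¬z≢u))
        {z} (λ z≢z → z≢z refl)
        (allFin n) (λ {v} _ → ∈-allFin v)
        (≤-trans (≤-reflexive (length-tabulate _)) (n≤1+n n))
        z≢r (λ _ _ → inj₁ refl)

corollary5p4 : ∀ (t : ℕ) → 2 ≤ t → ∀ {n : ℕ} (G : Graph n) → Connected G → MinorFree (K 3 t) G → ∃[ c ] (IsCopNumber G c × c ≤ t)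
corollary5p4 t 2≤t {zero} G connected free =
  -- On no vertices the robber has no play, so zero cops win vacuously.
  let c , isCopNumber , c≤0 = Game.copNumber≤ G (idleCops , λ ρ → contradiction (ρ 0) λ ())
  in c , isCopNumber , ≤-trans c≤0 z≤n
  where
  idleCops : CopStrategy G 0
  idleCops = record { position = λ _ () ; legal = λ _ _ () }
corollary5p4 (suc (suc t)) 2≤t {suc n} G connected free =
  Game.copNumber≤ G (Pursuit.copsWin G connected (suc (suc t)) free {zero} {suc zero} (λ ()) zero)
corollary5p4 (suc zero) (s≤s ())
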